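{- Let $(\mathscr{R}_n(x))_{n\ge 0}$ be the polynomials defined by $\mathscr{R}_0(x)=1$ and $$\mathscr{R}_{n+1}(x)=(2nx+1)x\,\mathscr{R}_n(x)+x(1-x^2)\,\frac{d}{dx}\mathscr{R}_n(x)\qquad (n\ge 0)$$ (so $\mathscr{R}_1(x)=x$). Then $\mathscr{R}_n(x)$ is Hurwitz stable for every $n\in\mathbb{N}$.
   Context: $\mathbb{N}$ denotes the nonnegative integers. A polynomial $f\in\mathbb{C}[x]$ is Hurwitz stable if it is identically zero or $f(x)\ne 0$ whenever $\Re(x)>0$. (The coefficient of $x^k$ in $\mathscr{R}_n(x)$ counts the elements with $k$ alternating runs in a dual set of Stirling permutations of order $n$; this is not needed for the statement.) -}

module Defs where

open import Algebra.Bundles using (RawRing)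
import Algebra.Definitions.RawSemiring as RawSemiringOps
open import Data.List.Base using (List; []; _∷_; map)
open import Data.Nat.Base as ℕ using (ℕ; zero; suc)
import Data.Nat.Properties as ℕ
open import Data.Product.Base using (∃-syntax; _×_; _,_)
open import Data.Rational.Base as ℚ
  using (ℚ; 0ℚ; 1ℚ; ½; ∣_∣; 1/_; Positive; positive)
import Data.Rational.Properties as ℚ
open import Data.Rational.Solver using (module +-*-Solver)
open import Data.Sum.Base using (_⊎_)
open import Level using (Level; 0ℓ)
open import Relation.Binary.PropositionalEquality
  using (_≡_; refl; cong; sym; subst; trans)
open import Relation.Nullary.Negation.Core using (¬_)

------------------------------------------------------------------------
-- Real numbers: Cauchy sequences of rationals, compared by a setoid
-- equality.

IsCauchy : (ℕ → ℚ) → Set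
IsCauchy s = ∀ ε → 0ℚ ℚ.< ε →
  ∃[ N ] ∀ m n → N ℕ.≤ m → N ℕ.≤ n → ∣ s m ℚ.- s n ∣ ℚ.< ε

record ℝ : Set where
  constructor mkℝ
  field
    seq    : ℕ → ℚ
    cauchy : IsCauchy seq

open ℝ public

infix 4 _≈ᵣ_ _<ᵣ_

_≈ᵣ_ : ℝ → ℝ → Set
x ≈ᵣ y = ∀ ε → 0ℚ ℚ.< ε →
  ∃[ N ] ∀ n → N ℕ.≤ n → ∣ seq x n ℚ.- seq y n ∣ ℚ.< ε

-- A uniform gap ε is needed: termwise s n < t n only gives ≤ in the limit.
_<ᵣ_ : ℝ → ℝ → Set
x <ᵣ y = ∃[ ε ] 0ℚ ℚ.< ε × ∃[ N ] ∀ n → N ℕ.≤ n → seq x n ℚ.+ ε ℚ.< seq y n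

private
  half-pos : ∀ {ε} → 0ℚ ℚ.< ε → 0ℚ ℚ.< ε ℚ.* ½
  half-pos {ε} 0<ε = ℚ.positive⁻¹ _ {{ℚ.pos*pos⇒pos ε {{positive 0<ε}} ½}}

  halves : ∀ ε → ε ℚ.* ½ ℚ.+ ε ℚ.* ½ ≡ ε
  halves ε = trans (sym (ℚ.*-distribˡ-+ ε ½ ½)) (ℚ.*-identityʳ ε)

  const-cauchy : ∀ q → IsCauchy (λ _ → q)
  const-cauchy q ε 0<ε = 0 , λ _ _ _ _ →
    subst (ℚ._< ε) (cong ∣_∣ (sym (ℚ.+-inverseʳ q))) 0<ε

  neg-cauchy : ∀ {s} → IsCauchy s → IsCauchy (λ n → ℚ.- s n)
  neg-cauchy {s} cs ε 0<ε with cs ε 0<ε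
  ... | N , h = N , λ m n N≤m N≤n → subst (ℚ._< ε) (eq (s m) (s n)) (h m n N≤m N≤n)
    where
    open +-*-Solver
    eq : ∀ a b → ∣ a ℚ.- b ∣ ≡ ∣ ℚ.- a ℚ.- ℚ.- b ∣
    eq a b = trans (sym (ℚ.∣-p∣≡∣p∣ (a ℚ.- b)))
      (cong ∣_∣ (solve 2 (λ a b → :- (a :- b) := :- a :- :- b) refl a b))

  +-cauchy : ∀ {s t} → IsCauchy s → IsCauchy t → IsCauchy (λ n → s n ℚ.+ t n)
  +-cauchy {s} {t} cs ct ε 0<ε with cs (ε ℚ.* ½) (half-pos 0<ε) | ct (ε ℚ.* ½) (half-pos 0<ε)
  ... | N , h | M , k = N ℕ.⊔ M , λ m n le le′ →
    ℚ.≤-<-trans (bound (s m) (s n) (t m) (t n))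
      (subst (_ ℚ.<_) (halves ε)
        (ℚ.+-mono-< (h m n (ℕ.m⊔n≤o⇒m≤o N M le) (ℕ.m⊔n≤o⇒m≤o N M le′))
                    (k m n (ℕ.m⊔n≤o⇒n≤o N M le) (ℕ.m⊔n≤o⇒n≤o N M le′))))
    where
    open +-*-Solver
    bound : ∀ a b c d → ∣ (a ℚ.+ c) ℚ.- (b ℚ.+ d) ∣ ℚ.≤ ∣ a ℚ.- b ∣ ℚ.+ ∣ c ℚ.- d ∣
    bound a b c d = subst (λ e → ∣ e ∣ ℚ.≤ ∣ a ℚ.- b ∣ ℚ.+ ∣ c ℚ.- d ∣)
      (solve 4 (λ a b c d → (a :- b) :+ (c :- d) := (a :+ c) :- (b :+ d)) refl a b c d)
      (ℚ.∣p+q∣≤∣p∣+∣q∣ (a ℚ.- b) (c ℚ.- d))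

  eventually-bounded : ∀ {s} → IsCauchy s →
    ∃[ B ] 0ℚ ℚ.< B × ∃[ N ] ∀ n → N ℕ.≤ n → ∣ s n ∣ ℚ.≤ B
  eventually-bounded {s} cs with cs 1ℚ (ℚ.positive⁻¹ 1ℚ)
  ... | N , h = 1ℚ ℚ.+ ∣ s N ∣
    , ℚ.+-mono-<-≤ (ℚ.positive⁻¹ 1ℚ) (ℚ.0≤∣p∣ (s N))
    , N , λ n N≤n →
      ℚ.≤-trans (subst (λ e → ∣ e ∣ ℚ.≤ ∣ s n ℚ.- s N ∣ ℚ.+ ∣ s N ∣)
                   (solve 2 (λ a b → (a :- b) :+ b := a) refl (s n) (s N))
                   (ℚ.∣p+q∣≤∣p∣+∣q∣ (s n ℚ.- s N) (s N)))
                (ℚ.+-monoˡ-≤ ∣ s N ∣ (ℚ.<⇒≤ (h n N N≤n ℕ.≤-refl)))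
    where open +-*-Solver

  *-bound : ∀ {a b B δ} → 0ℚ ℚ.< B → ∣ a ∣ ℚ.≤ B → ∣ b ∣ ℚ.< δ → ∣ a ℚ.* b ∣ ℚ.< B ℚ.* δ
  *-bound {a} {b} {B} {δ} 0<B a≤B b<δ = subst (ℚ._< B ℚ.* δ) (sym (ℚ.∣p*q∣≡∣p∣*∣q∣ a b))
    (ℚ.≤-<-trans (ℚ.*-monoʳ-≤-nonNeg ∣ b ∣ {{ℚ.∣-∣-nonNeg b}} a≤B)
                 (ℚ.*-monoʳ-<-pos B {{positive 0<B}} b<δ))

  *-split : ∀ a b c d →
    ∣ a ℚ.* c ℚ.- b ℚ.* d ∣ ℚ.≤ ∣ a ℚ.* (c ℚ.- d) ∣ ℚ.+ ∣ d ℚ.* (a ℚ.- b) ∣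
  *-split a b c d =
    subst (λ e → ∣ e ∣ ℚ.≤ ∣ a ℚ.* (c ℚ.- d) ∣ ℚ.+ ∣ d ℚ.* (a ℚ.- b) ∣)
      (solve 4 (λ a b c d → a :* (c :- d) :+ d :* (a :- b) := a :* c :- b :* d) refl a b c d)
      (ℚ.∣p+q∣≤∣p∣+∣q∣ (a ℚ.* (c ℚ.- d)) (d ℚ.* (a ℚ.- b)))
    where open +-*-Solver

  *-share : ∀ {A B ε} → 0ℚ ℚ.< A → 0ℚ ℚ.< B → 0ℚ ℚ.< ε →
    ∃[ δ ] 0ℚ ℚ.< δ × A ℚ.* δ ℚ.+ B ℚ.* δ ≡ ε
  *-share {A} {B} {ε} 0<A 0<B 0<ε = share (A ℚ.+ B) {{positive (ℚ.+-mono-< 0<A 0<B)}} refl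
    where
    share : ∀ C .{{_ : Positive C}} → A ℚ.+ B ≡ C →
      ∃[ δ ] 0ℚ ℚ.< δ × A ℚ.* δ ℚ.+ B ℚ.* δ ≡ ε
    share C A+B≡C = r ℚ.* ε
      , ℚ.positive⁻¹ (r ℚ.* ε) {{ℚ.pos*pos⇒pos r {{ℚ.1/pos⇒pos C}} ε {{positive 0<ε}}}}
      , trans (sym (ℚ.*-distribʳ-+ (r ℚ.* ε) A B))
          (trans (cong (ℚ._* (r ℚ.* ε)) A+B≡C)
            (trans (sym (ℚ.*-assoc C r ε))
              (trans (cong (ℚ._* ε) (ℚ.*-inverseʳ C {{ℚ.pos⇒nonZero C}})) (ℚ.*-identityˡ ε))))
      where
      r : ℚ
      r = (1/ C) {{ℚ.pos⇒nonZero C}}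

  *-close : ∀ {a b c d A B δ ε} → 0ℚ ℚ.< A → 0ℚ ℚ.< B → A ℚ.* δ ℚ.+ B ℚ.* δ ≡ ε →
    ∣ a ∣ ℚ.≤ A → ∣ d ∣ ℚ.≤ B → ∣ a ℚ.- b ∣ ℚ.< δ → ∣ c ℚ.- d ∣ ℚ.< δ →
    ∣ a ℚ.* c ℚ.- b ℚ.* d ∣ ℚ.< ε
  *-close {a} {b} {c} {d} {A} {B} {δ} 0<A 0<B refl a≤A d≤B ab cd =
    ℚ.≤-<-trans (*-split a b c d)
      (ℚ.+-mono-< {∣ a ℚ.* (c ℚ.- d) ∣} {A ℚ.* δ} {∣ d ℚ.* (a ℚ.- b) ∣} {B ℚ.* δ}
        (*-bound {a} {c ℚ.- d} {A} {δ} 0<A a≤A cd)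
        (*-bound {d} {a ℚ.- b} {B} {δ} 0<B d≤B ab))

  *-cauchy : ∀ {s t} → IsCauchy s → IsCauchy t → IsCauchy (λ n → s n ℚ.* t n)
  *-cauchy {s} {t} cs ct ε 0<ε =
    let A , 0<A , N₁ , hA = eventually-bounded {s} cs
        B , 0<B , N₂ , hB = eventually-bounded {t} ct
        δ , 0<δ , δ-eq = *-share 0<A 0<B 0<ε
        N₃ , hs = cs δ 0<δ
        N₄ , ht = ct δ 0<δ
    in (N₁ ℕ.⊔ N₂) ℕ.⊔ (N₃ ℕ.⊔ N₄) , λ m n le le′ →
    let l  = ℕ.m⊔n≤o⇒m≤o (N₁ ℕ.⊔ N₂) (N₃ ℕ.⊔ N₄) le
        l′ = ℕ.m⊔n≤o⇒m≤o (N₁ ℕ.⊔ N₂) (N₃ ℕ.⊔ N₄) le′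
        r  = ℕ.m⊔n≤o⇒n≤o (N₁ ℕ.⊔ N₂) (N₃ ℕ.⊔ N₄) le
        r′ = ℕ.m⊔n≤o⇒n≤o (N₁ ℕ.⊔ N₂) (N₃ ℕ.⊔ N₄) le′
    in *-close {s m} {s n} {t m} {t n} {A} {B} {δ} {ε} 0<A 0<B δ-eq
         (hA m (ℕ.m⊔n≤o⇒m≤o N₁ N₂ l)) (hB n (ℕ.m⊔n≤o⇒n≤o N₁ N₂ l′))
         (hs m n (ℕ.m⊔n≤o⇒m≤o N₃ N₄ r) (ℕ.m⊔n≤o⇒m≤o N₃ N₄ r′))
         (ht m n (ℕ.m⊔n≤o⇒n≤o N₃ N₄ r) (ℕ.m⊔n≤o⇒n≤o N₃ N₄ r′))

infixl 6 _+ᵣ_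
infixl 7 _*ᵣ_
infix  8 -ᵣ_

0ᵣ 1ᵣ : ℝ
0ᵣ = mkℝ (λ _ → 0ℚ) (const-cauchy 0ℚ)
1ᵣ = mkℝ (λ _ → 1ℚ) (const-cauchy 1ℚ)

_+ᵣ_ _*ᵣ_ : ℝ → ℝ → ℝ
x +ᵣ y = mkℝ (λ n → seq x n ℚ.+ seq y n) (+-cauchy {seq x} {seq y} (cauchy x) (cauchy y))
x *ᵣ y = mkℝ (λ n → seq x n ℚ.* seq y n) (*-cauchy {seq x} {seq y} (cauchy x) (cauchy y))

-ᵣ_ : ℝ → ℝ
-ᵣ x = mkℝ (λ n → ℚ.- seq x n) (neg-cauchy {seq x} (cauchy x))

------------------------------------------------------------------------
-- Complex numbers

infix 5 _+i_

record ℂ : Set where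
  constructor _+i_
  field
    Re Im : ℝ

open ℂ public

ℂ-rawRing : RawRing 0ℓ 0ℓ
ℂ-rawRing = record
  { Carrier = ℂ
  ; _≈_     = λ z w → Re z ≈ᵣ Re w × Im z ≈ᵣ Im w
  ; _+_     = λ z w → (Re z +ᵣ Re w) +i (Im z +ᵣ Im w)
  ; _*_     = λ z w → (Re z *ᵣ Re w +ᵣ -ᵣ (Im z *ᵣ Im w))
                   +i (Re z *ᵣ Im w +ᵣ Im z *ᵣ Re w)
  ; -_      = λ z → (-ᵣ Re z) +i (-ᵣ Im z)
  ; 0#      = 0ᵣ +i 0ᵣ
  ; 1#      = 1ᵣ +i 0ᵣ
  }

------------------------------------------------------------------------
-- Univariate polynomials, as coefficient lists with the constant
-- coefficient first. Trailing zeros are allowed, so polynomial equality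
-- is equality of all coefficients.

module Polynomials {c ℓ : Level} (K : RawRing c ℓ) where

  private
    module K = RawRing K
    module KOps = RawSemiringOps K.rawSemiring

  Poly : Set c
  Poly = List K.Carrier

  coeff : Poly → ℕ → K.Carrier
  coeff []      _       = K.0#
  coeff (a ∷ _) zero    = a
  coeff (_ ∷ p) (suc k) = coeff p k

  _+ₚ_ : Poly → Poly → Poly
  []      +ₚ q       = q
  (a ∷ p) +ₚ []      = a ∷ p
  (a ∷ p) +ₚ (b ∷ q) = (a K.+ b) ∷ (p +ₚ q)

  _*ₚ_ : Poly → Poly → Poly
  []      *ₚ q = []
  (a ∷ p) *ₚ q = map (a K.*_) q +ₚ (K.0# ∷ (p *ₚ q))

  Poly-rawRing : RawRing c ℓ
  Poly-rawRing = record
    { Carrier = Poly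
    ; _≈_     = λ p q → ∀ k → coeff p k K.≈ coeff q k
    ; _+_     = _+ₚ_
    ; _*_     = _*ₚ_
    ; -_      = map (K.-_)
    ; 0#      = []
    ; 1#      = K.1# ∷ []
    }

  X : Poly
  X = K.0# ∷ K.1# ∷ []

  eval : Poly → K.Carrier → K.Carrier
  eval []      z = K.0#
  eval (a ∷ p) z = a K.+ z K.* eval p z

  -- Multiplies successive entries by k, k + 1, k + 2, …
  scaleFrom : ℕ → Poly → Poly
  scaleFrom k []      = []
  scaleFrom k (a ∷ p) = (k KOps.× a) ∷ scaleFrom (suc k) p

  d/dx : Poly → Poly
  d/dx []      = []
  d/dx (_ ∷ p) = scaleFrom 1 p

  open RawRing Poly-rawRing using (_+_; _*_; -_; 1#; rawSemiring)
  open RawSemiringOps rawSemiring using (_^_) renaming (_×_ to _•_)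

  -- _•_ is the natural-number multiple: (2 ℕ.* n) • X is 2nx.
  ℛ : ℕ → Poly
  ℛ zero    = 1#
  ℛ (suc n) = ((2 ℕ.* n) • X + 1#) * X * ℛ n + X * (1# + - (X ^ 2)) * d/dx (ℛ n)

open Polynomials ℂ-rawRing public

HurwitzStable : Poly → Set
HurwitzStable f = f ≈ₚ 0ₚ ⊎ (∀ z → 0ᵣ <ᵣ Re z → ¬ (eval f z ≈ 0#))
  where
  open RawRing ℂ-rawRing using (_≈_; 0#)
  open RawRing Poly-rawRing using () renaming (_≈_ to _≈ₚ_; 0# to 0ₚ)

-- ℛ n is the restriction to the diagonal (x , 1 + x²) of a polynomial ℱ n that is
-- linear in each of n pairs of variables (aⱼ , bⱼ):
--   ℱ 0 = 1,   ℱ (n + 1) = a₀ (ℱ n + D (ℱ n)),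
-- where D sums over j the substitution aⱼ ↦ bⱼ, bⱼ ↦ 4aⱼ. If F is such a
-- multilinear polynomial without zeros on the domain Re (aⱼ / bⱼ) > 0 for all j,
-- write F = αa + βb in one pair. Then Re (α / β) ≥ 0, since otherwise (- β , α) would
-- be a zero in the domain, and so
--   Re ((αb + 4βa) · conj (αa + βb))
--     = (∣α∣² + 4∣β∣²) Re (a · conj b) + (∣b∣² + 4∣a∣²) Re (α · conj β) ≥ 0.
-- Summing over the pairs gives Re (D F · conj F) ≥ 0, so F + D F has no zeros on the
-- domain either. Finally Re x > 0 implies Re (x / (1 + x²)) > 0.
module Submission where

open import Algebra.Bundles using (RawRing; CommutativeRing)
import Algebra.Definitions.RawSemiring as RawSemiringOps
open import Algebra.Morphism.Structures using (module RingMorphisms)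
import Algebra.Properties.CommutativeSemigroup as CommutativeSemigroupProperties
import Algebra.Properties.Ring as RingProperties
import Algebra.Properties.Semiring.Mult as SemiringMult
import Algebra.Solver.Ring.NaturalCoefficients.Default as SemiringSolver
open import Algebra.Structures using (IsCommutativeRing)
open import Data.List.Base using ([]; _∷_; map)
open import Data.Nat.Base as ℕ using (ℕ; zero; suc)
import Data.Nat.Properties as ℕ
open import Data.Product.Base using (∃-syntax; _×_; _,_; proj₁; proj₂)
open import Data.Rational.Base as ℚ using (ℚ; 0ℚ; 1ℚ; ½; ∣_∣; 1/_; positive; nonNegative)
import Data.Rational.Properties as ℚ
open import Data.Rational.Solver using (module +-*-Solver)
open import Data.Sum.Base using (inj₁; inj₂)
open import Data.Vec.Base using (Vec; []; _∷_; replicate)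
open import Data.Vec.Relation.Unary.All using (All; []; _∷_)
open import Function.Base using (id)
open import Level using (Level; 0ℓ)
import Relation.Binary.Reasoning.Setoid as SetoidReasoning
open import Relation.Binary.PropositionalEquality as ≡ using (_≡_)
open import Relation.Nullary.Negation.Core using (¬_)
open import Defs

private variable
  k ℓᵏ c ℓ : Level

-- Dual numbers over a commutative ring.

module _ (A : CommutativeRing c ℓ) where

  open CommutativeRing A
  open SemiringSolver commutativeSemiring using (solve; _:=_; _:+_; _:*_; con)

  -- The ring A[ε] with ε² = 0, the pair `x , x′` being x + x′ε. Computing at z + ε carries a
  -- derivative along in the second component, so forms can be differentiated along a curve without
  -- a separate calculus for them.
  dualNumbers : CommutativeRing c ℓ
  dualNumbers = record
    { Carrier = Carrier × Carrier
    ; _≈_ = λ x y → proj₁ x ≈ proj₁ y × proj₂ x ≈ proj₂ y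
    ; _+_ = λ x y → proj₁ x + proj₁ y , proj₂ x + proj₂ y
    ; _*_ = λ x y → proj₁ x * proj₁ y , proj₁ x * proj₂ y + proj₂ x * proj₁ y
    ; -_ = λ x → - proj₁ x , - proj₂ x
    ; 0# = 0# , 0#
    ; 1# = 1# , 0#
    ; isCommutativeRing = record
      { isRing = record
        { +-isAbelianGroup = record
          { isGroup = record
            { isMonoid = record
              { isSemigroup = record
                { isMagma = record
                  { isEquivalence = record
                    { refl = refl , refl
                    ; sym = λ (p , q) → sym p , sym q
                    ; trans = λ (p , q) (p′ , q′) → trans p p′ , trans q q′
                    }
                  ; ∙-cong = λ (p , q) (p′ , q′) → +-cong p p′ , +-cong q q′
                  }
                ; assoc = λ _ _ _ → +-assoc _ _ _ , +-assoc _ _ _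
                }
              ; identity = (λ _ → +-identityˡ _ , +-identityˡ _)
                         , (λ _ → +-identityʳ _ , +-identityʳ _)
              }
            ; inverse = (λ _ → -‿inverseˡ _ , -‿inverseˡ _)
                      , (λ _ → -‿inverseʳ _ , -‿inverseʳ _)
            ; ⁻¹-cong = λ (p , q) → -‿cong p , -‿cong q
            }
          ; comm = λ _ _ → +-comm _ _ , +-comm _ _
          }
        ; *-cong = λ (p , q) (p′ , q′) → *-cong p p′ , +-cong (*-cong p q′) (*-cong q p′)
        ; *-assoc = λ (a , a′) (b , b′) (c , c′) → *-assoc a b c ,
            solve 6 (λ a a′ b b′ c c′ →
              (a :* b) :* c′ :+ (a :* b′ :+ a′ :* b) :* c :=
              a :* (b :* c′ :+ b′ :* c) :+ a′ :* (b :* c)) refl a a′ b b′ c c′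
        ; *-identity = (λ (a , a′) → *-identityˡ a ,
              solve 2 (λ a a′ → con 1 :* a′ :+ con 0 :* a := a′) refl a a′)
            , (λ (a , a′) → *-identityʳ a ,
              solve 2 (λ a a′ → a :* con 0 :+ a′ :* con 1 := a′) refl a a′)
        ; distrib = (λ (a , a′) (b , b′) (c , c′) → distribˡ a b c ,
              solve 6 (λ a a′ b b′ c c′ →
                a :* (b′ :+ c′) :+ a′ :* (b :+ c) :=
                (a :* b′ :+ a′ :* b) :+ (a :* c′ :+ a′ :* c)) refl a a′ b b′ c c′)
            , (λ (a , a′) (b , b′) (c , c′) → distribʳ a b c ,
              solve 6 (λ a a′ b b′ c c′ →
                (b :+ c) :* a′ :+ (b′ :+ c′) :* a :=
                (b :* a′ :+ b′ :* a) :+ (c :* a′ :+ c′ :* a)) refl a a′ b b′ c c′)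
        }
      ; *-comm = λ (a , a′) (b , b′) → *-comm a b ,
          solve 4 (λ a a′ b b′ → a :* b′ :+ a′ :* b := b :* a′ :+ b′ :* a) refl a a′ b b′
      }
    }

-- Multilinear forms, the operator `D`, and their values.

module Evaluation (K : RawRing k ℓᵏ) where

  private
    module K = RawRing K
    module K-Ops = RawSemiringOps K.rawSemiring
    module Pol = Polynomials K
  open RawRing Pol.Poly-rawRing using () renaming
    (_+_ to infixl 6 _⊕_; _*_ to infixl 7 _⊗_; -_ to infix 8 ⊖_; 1# to 1ₚ; rawSemiring to Poly-rawSemiring)
  open RawSemiringOps Poly-rawSemiring using () renaming (_^_ to _^ₚ_; _×_ to _•_)

  -- form α β is α a + β b, where (a , b) is the first pair of variables.
  data Form : ℕ → Set k where
    const : K.Carrier → Form 0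
    form  : ∀ {n} → Form n → Form n → Form (suc n)

  infixl 6 _+ᶠ_

  _+ᶠ_ : ∀ {n} → Form n → Form n → Form n
  const a  +ᶠ const b    = const (a K.+ b)
  form α β +ᶠ form α′ β′ = form (α +ᶠ α′) (β +ᶠ β′)

  scale : ∀ {n} → K.Carrier → Form n → Form n
  scale a (const b)  = const (a K.* b)
  scale a (form α β) = form (scale a α) (scale a β)

  0ᶠ : ∀ n → Form n
  0ᶠ zero    = const K.0#
  0ᶠ (suc n) = form (0ᶠ n) (0ᶠ n)

  four : K.Carrier
  four = 4 K-Ops.× K.1#

  -- Under a ↦ b, b ↦ 4a the form α a + β b becomes 4β a + α b, so the coefficients of the first
  -- pair trade places. The substitutions in the remaining pairs act on the coefficients.
  D : ∀ {n} → Form n → Form n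
  D (const _)  = const K.0#
  D (form α β) = form (scale four β +ᶠ D α) (α +ᶠ D β)

  ℱ : ∀ n → Form n
  ℱ zero    = const K.1#
  ℱ (suc n) = form (ℱ n +ᶠ D (ℱ n)) (0ᶠ n)

  -- `⟦_⟧` is a bare function and A varies independently of K. Thus `Hom` over A can instantiate
  -- this module over the dual numbers of A as well, and the same polynomials and forms over K take
  -- values in both rings.
  module At (A : CommutativeRing c ℓ) (⟦_⟧ : K.Carrier → CommutativeRing.Carrier A) where

    open CommutativeRing A

    evalAt : Pol.Poly → Carrier → Carrier
    evalAt []      z = 0#
    evalAt (a ∷ p) z = ⟦ a ⟧ + z * evalAt p z

    value : ∀ {n} → Form n → Vec (Carrier × Carrier) n → Carrier
    value (const k)  []            = ⟦ k ⟧
    value (form α β) ((a , b) ∷ v) = a * value α v + b * value β v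

    diagonal : Carrier → ∀ {n} → Form n → Carrier
    diagonal z t = value t (replicate _ (z , 1# + z * z))

  module Hom (A : CommutativeRing c ℓ)
    {⟦_⟧ : K.Carrier → CommutativeRing.Carrier A}
    (⟦⟧-isHom : RingMorphisms.IsRingHomomorphism K (CommutativeRing.rawRing A) ⟦_⟧) where

    open At A ⟦_⟧ public
    open CommutativeRing A
    open RingMorphisms.IsRingHomomorphism ⟦⟧-isHom
    open SemiringMult semiring using (×-congʳ) renaming (_×_ to _×ᴬ_)
    open SemiringSolver commutativeSemiring using (solve; _:=_; _:+_; _:*_; con)
    open RingProperties ring
    open SetoidReasoning setoid

    4# : Carrier
    4# = 1# + (1# + (1# + 1#))

    ⟦four⟧ : ⟦ four ⟧ ≈ 4#
    ⟦four⟧ = begin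
      ⟦ four ⟧ ≈⟨ +-homo _ _ ⟩
      ⟦ K.1# ⟧ + ⟦ 3 K-Ops.× K.1# ⟧ ≈⟨ +-cong 1#-homo (+-homo _ _) ⟩
      1# + (⟦ K.1# ⟧ + ⟦ 2 K-Ops.× K.1# ⟧) ≈⟨ +-congˡ (+-cong 1#-homo (+-homo _ _)) ⟩
      1# + (1# + (⟦ K.1# ⟧ + ⟦ 1 K-Ops.× K.1# ⟧))
        ≈⟨ +-congˡ (+-congˡ (+-cong 1#-homo (trans (+-homo _ _) (+-cong 1#-homo 0#-homo)))) ⟩
      1# + (1# + (1# + (1# + 0#))) ≈⟨ +-congˡ (+-congˡ (+-congˡ (+-identityʳ 1#))) ⟩
      4# ∎

    value-+ : ∀ {n} (s t : Form n) v → value (s +ᶠ t) v ≈ value s v + value t v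
    value-+ (const a)  (const b)    []            = +-homo a b
    value-+ (form α β) (form α′ β′) ((a , b) ∷ v) = trans
      (+-cong (*-congˡ (value-+ α α′ v)) (*-congˡ (value-+ β β′ v)))
      (solve 6 (λ a b α β α′ β′ → a :* (α :+ α′) :+ b :* (β :+ β′) :=
        (a :* α :+ b :* β) :+ (a :* α′ :+ b :* β′)) refl a b _ _ _ _)

    value-scale : ∀ {n} r (t : Form n) v → value (scale r t) v ≈ ⟦ r ⟧ * value t v
    value-scale r (const a)  []            = *-homo r a
    value-scale r (form α β) ((a , b) ∷ v) = trans
      (+-cong (*-congˡ (value-scale r α v)) (*-congˡ (value-scale r β v)))
      (solve 5 (λ a b r α β → a :* (r :* α) :+ b :* (r :* β) :=
        r :* (a :* α :+ b :* β)) refl a b ⟦ r ⟧ _ _)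

    value-0 : ∀ n v → value (0ᶠ n) v ≈ 0#
    value-0 zero    []            = 0#-homo
    value-0 (suc n) ((a , b) ∷ v) = trans
      (+-cong (*-congˡ (value-0 n v)) (*-congˡ (value-0 n v)))
      (solve 2 (λ a b → a :* con 0 :+ b :* con 0 := con 0) refl a b)

    value-D : ∀ {n} (α β : Form n) a b v → value (D (form α β)) ((a , b) ∷ v) ≈
      a * (4# * value β v + value (D α) v) + b * (value α v + value (D β) v)
    value-D α β a b v = +-cong
      (*-congˡ (trans (value-+ (scale four β) (D α) v)
        (+-congʳ (trans (value-scale four β v) (*-congʳ ⟦four⟧)))))
      (*-congˡ (value-+ α (D β) v))

    -- This and `value-D-scale` give the linearity of `D`, which lets `D` pass through the form
    -- obtained by fixing the first pair at numbers. It is stated for values because K is a raw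
    -- ring, whose operations satisfy no laws on the forms themselves.
    value-D-+ : ∀ {n} (s t : Form n) v →
      value (D (s +ᶠ t)) v ≈ value (D s) v + value (D t) v
    value-D-+ (const a)  (const b)    []            =
      trans 0#-homo (sym (trans (+-cong 0#-homo 0#-homo) (+-identityʳ 0#)))
    value-D-+ (form α β) (form α′ β′) ((a , b) ∷ v) = begin
      value (D (form α β +ᶠ form α′ β′)) ((a , b) ∷ v)
        ≈⟨ value-D (α +ᶠ α′) (β +ᶠ β′) a b v ⟩
      a * (4# * value (β +ᶠ β′) v + value (D (α +ᶠ α′)) v)
        + b * (value (α +ᶠ α′) v + value (D (β +ᶠ β′)) v)
        ≈⟨ +-cong (*-congˡ (+-cong (*-congˡ (value-+ β β′ v)) (value-D-+ α α′ v)))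
             (*-congˡ (+-cong (value-+ α α′ v) (value-D-+ β β′ v))) ⟩
      a * (4# * (value β v + value β′ v) + (value (D α) v + value (D α′) v))
        + b * ((value α v + value α′ v) + (value (D β) v + value (D β′) v))
        ≈⟨ solve 11 (λ a b k α α′ β β′ Dα Dα′ Dβ Dβ′ →
             a :* (k :* (β :+ β′) :+ (Dα :+ Dα′)) :+ b :* ((α :+ α′) :+ (Dβ :+ Dβ′)) :=
             (a :* (k :* β :+ Dα) :+ b :* (α :+ Dβ)) :+ (a :* (k :* β′ :+ Dα′) :+ b :* (α′ :+ Dβ′)))
             refl a b 4# _ _ _ _ _ _ _ _ ⟩
      (a * (4# * value β v + value (D α) v) + b * (value α v + value (D β) v))
        + (a * (4# * value β′ v + value (D α′) v) + b * (value α′ v + value (D β′) v))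
        ≈⟨ +-cong (value-D α β a b v) (value-D α′ β′ a b v) ⟨
      value (D (form α β)) ((a , b) ∷ v) + value (D (form α′ β′)) ((a , b) ∷ v) ∎

    value-D-scale : ∀ {n} r (t : Form n) v →
      value (D (scale r t)) v ≈ ⟦ r ⟧ * value (D t) v
    value-D-scale r (const a)  []            =
      trans 0#-homo (sym (trans (*-congˡ 0#-homo) (zeroʳ ⟦ r ⟧)))
    value-D-scale r (form α β) ((a , b) ∷ v) = begin
      value (D (scale r (form α β))) ((a , b) ∷ v)
        ≈⟨ value-D (scale r α) (scale r β) a b v ⟩
      a * (4# * value (scale r β) v + value (D (scale r α)) v)
        + b * (value (scale r α) v + value (D (scale r β)) v)
        ≈⟨ +-cong (*-congˡ (+-cong (*-congˡ (value-scale r β v)) (value-D-scale r α v)))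
             (*-congˡ (+-cong (value-scale r α v) (value-D-scale r β v))) ⟩
      a * (4# * (⟦ r ⟧ * value β v) + ⟦ r ⟧ * value (D α) v)
        + b * (⟦ r ⟧ * value α v + ⟦ r ⟧ * value (D β) v)
        ≈⟨ solve 8 (λ a b k r α β Dα Dβ →
             a :* (k :* (r :* β) :+ r :* Dα) :+ b :* (r :* α :+ r :* Dβ) :=
             r :* (a :* (k :* β :+ Dα) :+ b :* (α :+ Dβ)))
             refl a b 4# ⟦ r ⟧ _ _ _ _ ⟩
      ⟦ r ⟧ * (a * (4# * value β v + value (D α) v) + b * (value α v + value (D β) v))
        ≈⟨ *-congˡ (value-D α β a b v) ⟨
      ⟦ r ⟧ * value (D (form α β)) ((a , b) ∷ v) ∎

    value-ℱ : ∀ n a b v → value (ℱ (suc n)) ((a , b) ∷ v) ≈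
      a * (value (ℱ n) v + value (D (ℱ n)) v)
    value-ℱ n a b v = begin
      a * value (ℱ n +ᶠ D (ℱ n)) v + b * value (0ᶠ n) v
        ≈⟨ +-cong (*-congˡ (value-+ (ℱ n) (D (ℱ n)) v)) (trans (*-congˡ (value-0 n v)) (zeroʳ b)) ⟩
      a * (value (ℱ n) v + value (D (ℱ n)) v) + 0# ≈⟨ +-identityʳ _ ⟩
      a * (value (ℱ n) v + value (D (ℱ n)) v) ∎

    -- Values of polynomials and the recurrence for `ℛ`.

    eval-+ : ∀ p q z → evalAt (p ⊕ q) z ≈ evalAt p z + evalAt q z
    eval-+ []      q       z = sym (+-identityˡ _)
    eval-+ (a ∷ p) []      z = sym (+-identityʳ _)
    eval-+ (a ∷ p) (b ∷ q) z = trans (+-cong (+-homo a b) (*-congˡ (eval-+ p q z)))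
      (solve 5 (λ a b z p q → (a :+ b) :+ z :* (p :+ q) := (a :+ z :* p) :+ (b :+ z :* q))
        refl ⟦ a ⟧ ⟦ b ⟧ z _ _)

    eval-map-* : ∀ a p z → evalAt (map (a K.*_) p) z ≈ ⟦ a ⟧ * evalAt p z
    eval-map-* a []      z = sym (zeroʳ _)
    eval-map-* a (b ∷ p) z = trans (+-cong (*-homo a b) (*-congˡ (eval-map-* a p z)))
      (solve 4 (λ a b z p → a :* b :+ z :* (a :* p) := a :* (b :+ z :* p)) refl ⟦ a ⟧ ⟦ b ⟧ z _)

    eval-* : ∀ p q z → evalAt (p ⊗ q) z ≈ evalAt p z * evalAt q z
    eval-* []      q z = sym (zeroˡ _)
    eval-* (a ∷ p) q z = begin
      evalAt (map (a K.*_) q ⊕ (K.0# ∷ (p ⊗ q))) z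
        ≈⟨ eval-+ (map (a K.*_) q) (K.0# ∷ (p ⊗ q)) z ⟩
      evalAt (map (a K.*_) q) z + (⟦ K.0# ⟧ + z * evalAt (p ⊗ q) z)
        ≈⟨ +-cong (eval-map-* a q z) (+-cong 0#-homo (*-congˡ (eval-* p q z))) ⟩
      ⟦ a ⟧ * evalAt q z + (0# + z * (evalAt p z * evalAt q z))
        ≈⟨ solve 4 (λ a z p q → a :* q :+ (con 0 :+ z :* (p :* q)) := (a :+ z :* p) :* q)
             refl ⟦ a ⟧ z _ _ ⟩
      (⟦ a ⟧ + z * evalAt p z) * evalAt q z ∎

    eval-neg : ∀ p z → evalAt (⊖ p) z ≈ - evalAt p z
    eval-neg []      z = sym -0#≈0#
    eval-neg (a ∷ p) z = begin
      ⟦ K.- a ⟧ + z * evalAt (⊖ p) z ≈⟨ +-cong (-‿homo a) (*-congˡ (eval-neg p z)) ⟩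
      - ⟦ a ⟧ + z * - evalAt p z     ≈⟨ +-congˡ (-‿distribʳ-* z _) ⟨
      - ⟦ a ⟧ + - (z * evalAt p z)   ≈⟨ -‿+-comm _ _ ⟩
      - (⟦ a ⟧ + z * evalAt p z)     ∎

    eval-1 : ∀ z → evalAt 1ₚ z ≈ 1#
    eval-1 z = trans (+-cong 1#-homo (zeroʳ z)) (+-identityʳ 1#)

    eval-X : ∀ z → evalAt Pol.X z ≈ z
    eval-X z = trans (+-cong 0#-homo (*-congˡ (eval-1 z)))
      (trans (+-identityˡ _) (*-identityʳ z))

    eval-• : ∀ m p z → evalAt (m • p) z ≈ m ×ᴬ evalAt p z
    eval-• zero    p z = refl
    eval-• (suc m) p z = trans (eval-+ p (m • p) z) (+-congˡ (eval-• m p z))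

    eval-ℛ-suc : ∀ n z → evalAt (Pol.ℛ (suc n)) z ≈
      (((2 ℕ.* n) ×ᴬ z + 1#) * z) * evalAt (Pol.ℛ n) z
        + (z * (1# + - (z * z))) * evalAt (Pol.d/dx (Pol.ℛ n)) z
    eval-ℛ-suc n z = begin
      evalAt (N ⊗ Pol.X ⊗ Pol.ℛ n ⊕ Pol.X ⊗ M ⊗ Pol.d/dx (Pol.ℛ n)) z
        ≈⟨ eval-+ (N ⊗ Pol.X ⊗ Pol.ℛ n) (Pol.X ⊗ M ⊗ Pol.d/dx (Pol.ℛ n)) z ⟩
      evalAt (N ⊗ Pol.X ⊗ Pol.ℛ n) z + evalAt (Pol.X ⊗ M ⊗ Pol.d/dx (Pol.ℛ n)) z
        ≈⟨ +-cong (eval-*₃ N Pol.X (Pol.ℛ n)) (eval-*₃ Pol.X M (Pol.d/dx (Pol.ℛ n))) ⟩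
      (evalAt N z * evalAt Pol.X z) * evalAt (Pol.ℛ n) z
        + (evalAt Pol.X z * evalAt M z) * evalAt (Pol.d/dx (Pol.ℛ n)) z
        ≈⟨ +-cong (*-congʳ (*-cong eval-N (eval-X z))) (*-congʳ (*-cong (eval-X z) eval-M)) ⟩
      (((2 ℕ.* n) ×ᴬ z + 1#) * z) * evalAt (Pol.ℛ n) z
        + (z * (1# + - (z * z))) * evalAt (Pol.d/dx (Pol.ℛ n)) z ∎
      where
      N M : Pol.Poly
      N = (2 ℕ.* n) • Pol.X ⊕ 1ₚ
      M = 1ₚ ⊕ ⊖ (Pol.X ^ₚ 2)
      eval-*₃ : ∀ p q r → evalAt (p ⊗ q ⊗ r) z ≈ (evalAt p z * evalAt q z) * evalAt r z
      eval-*₃ p q r = trans (eval-* (p ⊗ q) r z) (*-congʳ (eval-* p q z))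
      eval-N : evalAt N z ≈ (2 ℕ.* n) ×ᴬ z + 1#
      eval-N = trans (eval-+ ((2 ℕ.* n) • Pol.X) 1ₚ z) (+-cong
        (trans (eval-• (2 ℕ.* n) Pol.X z) (×-congʳ (2 ℕ.* n) (eval-X z))) (eval-1 z))
      eval-X² : evalAt (Pol.X ^ₚ 2) z ≈ z * z
      eval-X² = trans (eval-* Pol.X (Pol.X ⊗ 1ₚ) z) (*-cong (eval-X z)
        (trans (eval-* Pol.X 1ₚ z) (trans (*-cong (eval-X z) (eval-1 z)) (*-identityʳ z))))
      eval-M : evalAt M z ≈ 1# + - (z * z)
      eval-M = trans (eval-+ 1ₚ (⊖ (Pol.X ^ₚ 2)) z)
        (+-cong (eval-1 z) (trans (eval-neg (Pol.X ^ₚ 2) z) (-‿cong eval-X²)))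

    eval-scaleFrom-suc : ∀ m p z →
      evalAt (Pol.scaleFrom (suc m) p) z ≈ evalAt p z + evalAt (Pol.scaleFrom m p) z
    eval-scaleFrom-suc m []      z = sym (+-identityˡ _)
    eval-scaleFrom-suc m (a ∷ p) z =
      trans (+-cong (+-homo a _) (*-congˡ (eval-scaleFrom-suc (suc m) p z)))
        (solve 5 (λ a b z p q → (a :+ b) :+ z :* (p :+ q) := (a :+ z :* p) :+ (b :+ z :* q))
          refl ⟦ a ⟧ _ z _ _)

    eval-scaleFrom-0 : ∀ p z → evalAt (Pol.scaleFrom 0 p) z ≈ z * evalAt (Pol.d/dx p) z
    eval-scaleFrom-0 []      z = sym (zeroʳ z)
    eval-scaleFrom-0 (a ∷ p) z = trans (+-congʳ 0#-homo) (+-identityˡ _)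

    -- The product rule (a + x p)′ = p + x p′. The derivative is defined by a running counter:
    -- starting it at 1 instead of 0 adds one copy of p, and starting it at 0 kills the constant
    -- term and leaves x p′.
    eval-d/dx-∷ : ∀ a p z → evalAt (Pol.d/dx (a ∷ p)) z ≈ evalAt p z + z * evalAt (Pol.d/dx p) z
    eval-d/dx-∷ a p z = trans (eval-scaleFrom-suc 0 p z) (+-congˡ (eval-scaleFrom-0 p z))

    -- Derivatives through dual numbers.

    dual : K.Carrier → Carrier × Carrier
    dual a = ⟦ a ⟧ , 0#

    dual-isHom :
      RingMorphisms.IsRingHomomorphism K (CommutativeRing.rawRing (dualNumbers A)) dual
    dual-isHom = record
      { isSemiringHomomorphism = record
        { isNearSemiringHomomorphism = record
          { +-isMonoidHomomorphism = record
            { isMagmaHomomorphism = record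
              { isRelHomomorphism = record { cong = λ a≈b → ⟦⟧-cong a≈b , refl }
              ; homo = λ a b → +-homo a b , sym (+-identityˡ 0#)
              }
            ; ε-homo = 0#-homo , refl
            }
          ; *-homo = λ a b → *-homo a b ,
              solve 2 (λ a b → con 0 := a :* con 0 :+ con 0 :* b) refl ⟦ a ⟧ ⟦ b ⟧
          }
        ; 1#-homo = 1#-homo , refl
        }
      ; -‿homo = λ a → -‿homo a , sym -0#≈0#
      }

    module Dual = At (dualNumbers A) dual

    -- Taylor expansion p (z + ε) = p (z) + p′ (z) ε, exact because ε² = 0. The inductive step is
    -- the product rule `eval-d/dx-∷`.
    eval-dual : ∀ p z →
      (proj₁ (Dual.evalAt p (z , 1#)) ≈ evalAt p z) ×
      (proj₂ (Dual.evalAt p (z , 1#)) ≈ evalAt (Pol.d/dx p) z)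
    eval-dual []      z = refl , refl
    eval-dual (a ∷ p) z with eval-dual p z
    ... | p≈ , p′≈ = +-congˡ (*-congˡ p≈)
      , trans (+-identityˡ _) (trans (+-cong (*-congˡ p′≈) (trans (*-identityˡ _) p≈))
          (trans (+-comm _ _) (sym (eval-d/dx-∷ a p z))))

    value-dual : ∀ {n} (t : Form n) z →
      proj₁ (Dual.diagonal (z , 1#) t) ≈ diagonal z t
    value-dual (const a)  z = refl
    value-dual (form α β) z = +-cong (*-congˡ (value-dual α z)) (*-congˡ (value-dual β z))

    -- The chain rule along x ↦ (x , 1 + x²): each substitution summed in D
    -- is 2x·id + (1 - x²)·d/dx on linear forms in x and 1 + x².
    diagonal-D : ∀ {n} (t : Form n) z →
      diagonal z (D t) + z * z * proj₂ (Dual.diagonal (z , 1#) t) ≈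
      ((2 ℕ.* n) ×ᴬ z) * diagonal z t + proj₂ (Dual.diagonal (z , 1#) t)
    diagonal-D (const a) z = trans (+-cong 0#-homo (zeroʳ (z * z)))
      (+-congʳ (sym (zeroˡ _)))
    diagonal-D {suc n} (form α β) z = begin
      diagonal z (D (form α β)) + z * z * proj₂ (Dual.diagonal (z , 1#) (form α β))
        ≈⟨ +-cong (value-D α β z (1# + z * z) _)
             (*-congˡ (+-cong (+-congˡ (*-congˡ (value-dual α z)))
               (+-congˡ (*-congˡ (value-dual β z))))) ⟩
      z * (4# * b + Dα) + (1# + z * z) * (a + Dβ)
        + z * z * ((z * a′ + 1# * a) + ((1# + z * z) * b′ + (0# + (z * 1# + 1# * z)) * b))
        -- Regroups so that the left sides of the induction hypotheses for `α` and `β` appear,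
        -- leaving z² (a + 2zb) from differentiating z and 1 + z². Four is first spelled as nested
        -- ones to match `4#`.
        ≈⟨ solve 7 (λ z a b a′ b′ Dα Dβ →
             z :* ((con 1 :+ (con 1 :+ (con 1 :+ con 1))) :* b :+ Dα)
               :+ (con 1 :+ z :* z) :* (a :+ Dβ)
               :+ z :* z :* ((z :* a′ :+ con 1 :* a)
                 :+ ((con 1 :+ z :* z) :* b′ :+ (con 0 :+ (z :* con 1 :+ con 1 :* z)) :* b))
             := z :* (con 4 :* b :+ (Dα :+ z :* z :* a′))
               :+ (con 1 :+ z :* z) :* (a :+ (Dβ :+ z :* z :* b′))
               :+ z :* z :* (a :+ con 2 :* z :* b))
             refl z a b a′ b′ Dα Dβ ⟩
      z * ((1# + 1# + 1# + 1#) * b + (Dα + z * z * a′))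
        + (1# + z * z) * (a + (Dβ + z * z * b′))
        + z * z * (a + (1# + 1#) * z * b)
        ≈⟨ +-congʳ (+-cong (*-congˡ (+-congˡ (diagonal-D α z)))
             (*-congˡ (+-congˡ (diagonal-D β z)))) ⟩
      z * ((1# + 1# + 1# + 1#) * b + (u * a + a′))
        + (1# + z * z) * (a + (u * b + b′))
        + z * z * (a + (1# + 1#) * z * b)
        -- Apart from the terms in `u`, `a′` and `b′`, this is the case of a single pair: 4zb + (1 +
        -- z²) a + z² (a + 2zb) = 2z (za + (1 + z²) b) + (a + 2zb).
        ≈⟨ solve 6 (λ z a b a′ b′ u →
             z :* (con 4 :* b :+ (u :* a :+ a′))
               :+ (con 1 :+ z :* z) :* (a :+ (u :* b :+ b′))
               :+ z :* z :* (a :+ con 2 :* z :* b)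
             := (z :+ (z :+ u)) :* (z :* a :+ (con 1 :+ z :* z) :* b)
               :+ ((z :* a′ :+ con 1 :* a)
                 :+ ((con 1 :+ z :* z) :* b′ :+ (con 0 :+ (z :* con 1 :+ con 1 :* z)) :* b)))
             refl z a b a′ b′ u ⟩
      (z + (z + u)) * (z * a + (1# + z * z) * b)
        + ((z * a′ + 1# * a) + ((1# + z * z) * b′ + (0# + (z * 1# + 1# * z)) * b))
        ≈⟨ +-cong (*-congʳ (reflexive (≡.cong (_×ᴬ z) (≡.sym (ℕ.*-suc 2 n)))))
             (+-cong (+-congˡ (*-congˡ (sym (value-dual α z))))
               (+-congˡ (*-congˡ (sym (value-dual β z))))) ⟩
      ((2 ℕ.* suc n) ×ᴬ z) * diagonal z (form α β)
        + proj₂ (Dual.diagonal (z , 1#) (form α β)) ∎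
      where
      a = diagonal z α
      b = diagonal z β
      a′ = proj₂ (Dual.diagonal (z , 1#) α)
      b′ = proj₂ (Dual.diagonal (z , 1#) β)
      Dα = diagonal z (D α)
      Dβ = diagonal z (D β)
      u = (2 ℕ.* n) ×ᴬ z

  -- Induction over all rings A at once: the derivative in the recurrence is the
  -- dual part of the induction hypothesis at z + ε over A[ε].
  eval-ℛ : ∀ n (A : CommutativeRing c ℓ) {⟦_⟧ : K.Carrier → CommutativeRing.Carrier A}
    (⟦⟧-isHom : RingMorphisms.IsRingHomomorphism K (CommutativeRing.rawRing A) ⟦_⟧) z →
    CommutativeRing._≈_ A (At.evalAt A ⟦_⟧ (Pol.ℛ n) z) (At.diagonal A ⟦_⟧ z (ℱ n))
  eval-ℛ zero    A ⟦⟧-isHom z = trans (+-congˡ (zeroʳ z)) (+-identityʳ _)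
    where open CommutativeRing A
  eval-ℛ (suc n) A {⟦_⟧} ⟦⟧-isHom z = begin
    evalAt (Pol.ℛ (suc n)) z
      ≈⟨ eval-ℛ-suc n z ⟩
    ((u + 1#) * z) * evalAt (Pol.ℛ n) z + (z * (1# + - (z * z))) * evalAt (Pol.d/dx (Pol.ℛ n)) z
      ≈⟨ +-cong (*-congˡ (eval-ℛ n A ⟦⟧-isHom z))
           (*-congˡ (trans (sym (proj₂ (eval-dual (Pol.ℛ n) z)))
             (proj₂ (eval-ℛ n (dualNumbers A) dual-isHom (z , 1#))))) ⟩
    ((u + 1#) * z) * f + (z * (1# + - (z * z))) * f′
      -- Isolates u f + f′, the right side of `diagonal-D`. The solver works in semirings, so `m`
      -- stands for - z² as an atom; it cancels against the z² f′ brought in by `diagonal-D` only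
      -- afterwards.
      ≈⟨ solve 5 (λ u z f f′ m → ((u :+ con 1) :* z) :* f :+ (z :* (con 1 :+ m)) :* f′
           := z :* f :+ z :* (u :* f :+ f′) :+ z :* m :* f′) refl u z f f′ (- (z * z)) ⟩
    z * f + z * (u * f + f′) + z * - (z * z) * f′
      ≈⟨ +-congʳ (+-congˡ (*-congˡ (diagonal-D (ℱ n) z))) ⟨
    z * f + z * (Df + z * z * f′) + z * - (z * z) * f′
      ≈⟨ solve 5 (λ z f f′ Df m → z :* f :+ z :* (Df :+ z :* z :* f′) :+ z :* m :* f′
           := z :* (f :+ Df) :+ (z :* z :+ m) :* (z :* f′)) refl z f f′ Df (- (z * z)) ⟩
    z * (f + Df) + (z * z + - (z * z)) * (z * f′)
      ≈⟨ +-congˡ (trans (*-congʳ (-‿inverseʳ (z * z))) (zeroˡ _)) ⟩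
    z * (f + Df) + 0#
      ≈⟨ +-identityʳ _ ⟩
    z * (f + Df)
      ≈⟨ value-ℱ n z (1# + z * z) _ ⟨
    diagonal z (ℱ (suc n)) ∎
    where
    open CommutativeRing A
    open Hom A ⟦⟧-isHom
    open SemiringMult semiring using () renaming (_×_ to _×ᴬ_)
    open SemiringSolver commutativeSemiring using (solve; _:=_; _:+_; _:*_; con)
    open SetoidReasoning setoid
    f f′ Df u : Carrier
    f = diagonal z (ℱ n)
    f′ = proj₂ (Dual.diagonal (z , 1#) (ℱ n))
    Df = diagonal z (D (ℱ n))
    u = (2 ℕ.* n) ×ᴬ z

-- Limits of rational sequences: null, bounded and asymptotically nonnegative ones.

open +-*-Solver

Eventually : (ℕ → Set) → Set
Eventually P = ∃[ N ] ∀ n → N ℕ.≤ n → P n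

eventually-map : ∀ {P Q : ℕ → Set} → (∀ n → P n → Q n) → Eventually P → Eventually Q
eventually-map f (N , p) = N , λ n N≤n → f n (p n N≤n)

eventually-map₂ : ∀ {P Q R : ℕ → Set} → (∀ n → P n → Q n → R n) →
  Eventually P → Eventually Q → Eventually R
eventually-map₂ f (N , p) (M , q) = N ℕ.⊔ M , λ n le →
  f n (p n (ℕ.m⊔n≤o⇒m≤o N M le)) (q n (ℕ.m⊔n≤o⇒n≤o N M le))

0<½* : ∀ {ε} → 0ℚ ℚ.< ε → 0ℚ ℚ.< ½ ℚ.* ε
0<½* {ε} 0<ε = ℚ.positive⁻¹ _ {{ℚ.pos*pos⇒pos ½ ε {{positive 0<ε}}}}

½*+½* : ∀ ε → ½ ℚ.* ε ℚ.+ ½ ℚ.* ε ≡ ε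
½*+½* ε = ≡.trans (≡.sym (ℚ.*-distribʳ-+ ε ½ ½)) (ℚ.*-identityˡ ε)

0<* : ∀ {p q} → 0ℚ ℚ.< p → 0ℚ ℚ.< q → 0ℚ ℚ.< p ℚ.* q
0<* {p} {q} 0<p 0<q = ℚ.positive⁻¹ _ {{ℚ.pos*pos⇒pos p {{positive 0<p}} q {{positive 0<q}}}}

0≤* : ∀ {p q} → 0ℚ ℚ.≤ p → 0ℚ ℚ.≤ q → 0ℚ ℚ.≤ p ℚ.* q
0≤* {p} {q} 0≤p 0≤q = ≡.subst (ℚ._≤ p ℚ.* q) (ℚ.*-zeroʳ p)
  (ℚ.*-monoˡ-≤-nonNeg p {{nonNegative 0≤p}} 0≤q)

0≤² : ∀ p → 0ℚ ℚ.≤ p ℚ.* p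
0≤² p = ≡.subst (0ℚ ℚ.≤_) ∣p∣²≡p² (0≤* (ℚ.0≤∣p∣ p) (ℚ.0≤∣p∣ p))
  where
  ∣p∣²≡p² : ∣ p ∣ ℚ.* ∣ p ∣ ≡ p ℚ.* p
  ∣p∣²≡p² with ℚ.∣p∣≡p∨∣p∣≡-p p
  ... | inj₁ eq = ≡.cong₂ ℚ._*_ eq eq
  ... | inj₂ eq = ≡.trans (≡.cong₂ ℚ._*_ eq eq)
    (solve 1 (λ p → :- p :* :- p := p :* p) ≡.refl p)

p≤∣p∣ : ∀ p → p ℚ.≤ ∣ p ∣
p≤∣p∣ p with ℚ.≤-total 0ℚ p
... | inj₁ 0≤p = ℚ.≤-reflexive (≡.sym (ℚ.0≤p⇒∣p∣≡p 0≤p))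
... | inj₂ p≤0 = ℚ.≤-trans p≤0 (ℚ.0≤∣p∣ p)

quotient : ∀ {B ε} → 0ℚ ℚ.< B → 0ℚ ℚ.< ε → ∃[ δ ] 0ℚ ℚ.< δ × δ ℚ.* B ≡ ε
quotient {B} {ε} 0<B 0<ε = ε ℚ.* r , 0<* 0<ε (ℚ.positive⁻¹ r {{ℚ.1/pos⇒pos B}})
  , ≡.trans (ℚ.*-assoc ε r B) (≡.trans (≡.cong (ε ℚ.*_) (ℚ.*-inverseˡ B)) (ℚ.*-identityʳ ε))
  where
  instance
    B-positive = positive 0<B
    B-nonZero = ℚ.pos⇒nonZero B
  r : ℚ
  r = 1/ B

-- `x ≈ᵣ y` is by definition `Null` of the difference of the sequences. `NonNeg` expresses a
-- nonnegative limit; the slack ε makes it invariant under adding null sequences, which termwise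
-- nonnegativity is not.
Null Bounded NonNeg : (ℕ → ℚ) → Set
Null s    = ∀ ε → 0ℚ ℚ.< ε → Eventually (λ n → ∣ s n ∣ ℚ.< ε)
Bounded s = ∃[ B ] 0ℚ ℚ.< B × Eventually (λ n → ∣ s n ∣ ℚ.≤ B)
NonNeg s  = ∀ ε → 0ℚ ℚ.< ε → Eventually (λ n → ℚ.- ε ℚ.≤ s n)

cauchy⇒bounded : ∀ {s} → IsCauchy s → Bounded s
cauchy⇒bounded {s} s-cauchy with s-cauchy 1ℚ (ℚ.positive⁻¹ 1ℚ)
... | N , close = 1ℚ ℚ.+ ∣ s N ∣ , ℚ.+-mono-<-≤ (ℚ.positive⁻¹ 1ℚ) (ℚ.0≤∣p∣ (s N))
  , N , λ n N≤n → begin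
    ∣ s n ∣                    ≡⟨ ≡.cong ∣_∣ (solve 2 (λ x y → x := x :- y :+ y) ≡.refl (s n) (s N)) ⟩
    ∣ s n ℚ.- s N ℚ.+ s N ∣     ≤⟨ ℚ.∣p+q∣≤∣p∣+∣q∣ (s n ℚ.- s N) (s N) ⟩
    ∣ s n ℚ.- s N ∣ ℚ.+ ∣ s N ∣ ≤⟨ ℚ.+-monoˡ-≤ ∣ s N ∣ (ℚ.<⇒≤ (close n N N≤n ℕ.≤-refl)) ⟩
    1ℚ ℚ.+ ∣ s N ∣              ∎
  where open ℚ.≤-Reasoning

null-dominated : ∀ {s t : ℕ → ℚ} → (∀ n → ∣ s n ∣ ℚ.≤ ∣ t n ∣) → Null t → Null s
null-dominated s≤t t-null ε 0<ε =
  eventually-map (λ n t<ε → ℚ.≤-<-trans (s≤t n) t<ε) (t-null ε 0<ε)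

null-resp : ∀ {s t : ℕ → ℚ} → (∀ n → s n ≡ t n) → Null s → Null t
null-resp s≡t = null-dominated (λ n → ℚ.≤-reflexive (≡.cong ∣_∣ (≡.sym (s≡t n))))

null-0 : Null (λ _ → 0ℚ)
null-0 ε 0<ε = 0 , λ _ _ → 0<ε

null-neg : ∀ {s} → Null s → Null (λ n → ℚ.- s n)
null-neg {s} = null-dominated (λ n → ℚ.≤-reflexive (ℚ.∣-p∣≡∣p∣ (s n)))

null-+ : ∀ {s t : ℕ → ℚ} → Null s → Null t → Null (λ n → s n ℚ.+ t n)
null-+ {s} {t} s-null t-null ε 0<ε = eventually-map₂
  (λ n s<½ε t<½ε → ℚ.≤-<-trans (ℚ.∣p+q∣≤∣p∣+∣q∣ (s n) (t n))
    (≡.subst (∣ s n ∣ ℚ.+ ∣ t n ∣ ℚ.<_) (½*+½* ε) (ℚ.+-mono-< s<½ε t<½ε)))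
  (s-null _ (0<½* 0<ε)) (t-null _ (0<½* 0<ε))

null-*-bounded : ∀ {s t : ℕ → ℚ} → Null s → Bounded t → Null (λ n → s n ℚ.* t n)
null-*-bounded {s} {t} s-null (B , 0<B , t≤B) ε 0<ε =
  let δ , 0<δ , δB≡ε = quotient 0<B 0<ε in
  eventually-map₂
    (λ n s<δ t≤B → begin-strict
      ∣ s n ℚ.* t n ∣       ≡⟨ ℚ.∣p*q∣≡∣p∣*∣q∣ (s n) (t n) ⟩
      ∣ s n ∣ ℚ.* ∣ t n ∣   ≤⟨ ℚ.*-monoˡ-≤-nonNeg ∣ s n ∣ {{ℚ.∣-∣-nonNeg (s n)}} t≤B ⟩
      ∣ s n ∣ ℚ.* B         <⟨ ℚ.*-monoˡ-<-pos B {{positive 0<B}} s<δ ⟩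
      δ ℚ.* B               ≡⟨ δB≡ε ⟩
      ε                     ∎)
    (s-null δ 0<δ) t≤B
  where open ℚ.≤-Reasoning

-- Replaces division by r: eventually η ∣s∣ ≤ ∣r s∣, so a bound η ε on the product bounds s by ε.
null-cancel-* : ∀ {r s : ℕ → ℚ} {η} → 0ℚ ℚ.< η → Eventually (λ n → η ℚ.≤ r n) →
  Null (λ n → r n ℚ.* s n) → Null s
null-cancel-* {r} {s} {η} 0<η η≤r rs-null ε 0<ε = eventually-map₂
  (λ n η≤r rs<ηε → ℚ.*-cancelˡ-<-nonNeg η {{nonNegative (ℚ.<⇒≤ 0<η)}} (begin-strict
    η ℚ.* ∣ s n ∣         ≤⟨ ℚ.*-monoʳ-≤-nonNeg ∣ s n ∣ {{ℚ.∣-∣-nonNeg (s n)}} η≤r ⟩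
    r n ℚ.* ∣ s n ∣       ≡⟨ ≡.cong (ℚ._* ∣ s n ∣) (ℚ.0≤p⇒∣p∣≡p (ℚ.≤-trans (ℚ.<⇒≤ 0<η) η≤r)) ⟨
    ∣ r n ∣ ℚ.* ∣ s n ∣   ≡⟨ ℚ.∣p*q∣≡∣p∣*∣q∣ (r n) (s n) ⟨
    ∣ r n ℚ.* s n ∣       <⟨ rs<ηε ⟩
    η ℚ.* ε               ∎))
  η≤r (rs-null _ (0<* 0<η 0<ε))
  where open ℚ.≤-Reasoning

null-√ : ∀ {s} → Null (λ n → s n ℚ.* s n) → Null s
null-√ {s} ss-null ε 0<ε = eventually-map
  (λ n ss<εε → ℚ.≰⇒> λ ε≤s → ℚ.<-irrefl ≡.refl (begin-strict
    ε ℚ.* ε               ≤⟨ ℚ.*-monoˡ-≤-nonNeg ε {{nonNegative (ℚ.<⇒≤ 0<ε)}} ε≤s ⟩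
    ε ℚ.* ∣ s n ∣         ≤⟨ ℚ.*-monoʳ-≤-nonNeg ∣ s n ∣ {{ℚ.∣-∣-nonNeg (s n)}} ε≤s ⟩
    ∣ s n ∣ ℚ.* ∣ s n ∣   ≡⟨ ℚ.∣p*q∣≡∣p∣*∣q∣ (s n) (s n) ⟨
    ∣ s n ℚ.* s n ∣       <⟨ ss<εε ⟩
    ε ℚ.* ε               ∎))
  (ss-null _ (0<* 0<ε 0<ε))
  where open ℚ.≤-Reasoning

nonNeg-resp : ∀ {s t : ℕ → ℚ} → (∀ n → s n ≡ t n) → NonNeg s → NonNeg t
nonNeg-resp s≡t s-nonNeg ε 0<ε =
  eventually-map (λ n → ≡.subst (ℚ.- ε ℚ.≤_) (s≡t n)) (s-nonNeg ε 0<ε)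

nonNeg-+ : ∀ {s t : ℕ → ℚ} → NonNeg s → NonNeg t → NonNeg (λ n → s n ℚ.+ t n)
nonNeg-+ {s} {t} s-nonNeg t-nonNeg ε 0<ε = eventually-map₂
  (λ n s≥ t≥ → ≡.subst (ℚ._≤ s n ℚ.+ t n)
    (≡.trans (≡.sym (ℚ.neg-distrib-+ (½ ℚ.* ε) (½ ℚ.* ε))) (≡.cong ℚ.-_ (½*+½* ε)))
    (ℚ.+-mono-≤ s≥ t≥))
  (s-nonNeg _ (0<½* 0<ε)) (t-nonNeg _ (0<½* 0<ε))

nonNeg-null-+ : ∀ {s t} → NonNeg s → Null t → NonNeg (λ n → s n ℚ.+ t n)
nonNeg-null-+ {s} {t} s-nonNeg t-null = nonNeg-+ s-nonNeg λ ε 0<ε → eventually-map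
  (λ n t<ε → ℚ.≤-trans (ℚ.neg-antimono-≤ (ℚ.≤-trans (-t≤∣t∣ n) (ℚ.<⇒≤ t<ε)))
    (ℚ.≤-reflexive (solve 1 (λ t → :- (:- t) := t) ≡.refl (t n))))
  (t-null ε 0<ε)
  where
  -t≤∣t∣ : ∀ n → ℚ.- t n ℚ.≤ ∣ t n ∣
  -t≤∣t∣ n = ≡.subst (ℚ.- t n ℚ.≤_) (ℚ.∣-p∣≡∣p∣ (t n)) (p≤∣p∣ (ℚ.- t n))

-- The factor t magnifies the slack of s by at most its bound B, so the slack δ = ε / B for s
-- suffices.
nonNeg-* : ∀ {s t : ℕ → ℚ} → NonNeg s → (∀ n → 0ℚ ℚ.≤ t n) → Bounded t → NonNeg (λ n → s n ℚ.* t n)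
nonNeg-* {s} {t} s-nonNeg 0≤t (B , 0<B , t≤B) ε 0<ε =
  let δ , 0<δ , δB≡ε = quotient 0<B 0<ε in
  eventually-map₂
    (λ n -δ≤s t≤B → begin
      ℚ.- ε               ≡⟨ ≡.cong ℚ.-_ δB≡ε ⟨
      ℚ.- (δ ℚ.* B)       ≤⟨ ℚ.neg-antimono-≤ (ℚ.*-monoˡ-≤-nonNeg δ {{nonNegative (ℚ.<⇒≤ 0<δ)}}
                               (≡.subst (ℚ._≤ B) (ℚ.0≤p⇒∣p∣≡p (0≤t n)) t≤B)) ⟩
      ℚ.- (δ ℚ.* t n)     ≡⟨ ℚ.neg-distribˡ-* δ (t n) ⟩
      ℚ.- δ ℚ.* t n       ≤⟨ ℚ.*-monoʳ-≤-nonNeg (t n) {{nonNegative (0≤t n)}} -δ≤s ⟩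
      s n ℚ.* t n         ∎)
    (s-nonNeg δ 0<δ) t≤B
  where open ℚ.≤-Reasoning

-- Write s = (s + t) - t. Eventually the first part is below ε / 2 and - t is at most ε / 2.
null-summand : ∀ {s t : ℕ → ℚ} → (∀ n → 0ℚ ℚ.≤ s n) → NonNeg t → Null (λ n → s n ℚ.+ t n) → Null s
null-summand {s} {t} 0≤s t-nonNeg s+t-null ε 0<ε = eventually-map₂
  (λ n -½ε≤t s+t<½ε → begin-strict
    ∣ s n ∣                                  ≡⟨ ℚ.0≤p⇒∣p∣≡p (0≤s n) ⟩
    s n                                      ≡⟨ solve 2 (λ s t → s := (s :+ t) :- t) ≡.refl (s n) (t n) ⟩
    (s n ℚ.+ t n) ℚ.- t n                    ≤⟨ ℚ.+-monoˡ-≤ (ℚ.- t n) (p≤∣p∣ (s n ℚ.+ t n)) ⟩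
    ∣ s n ℚ.+ t n ∣ ℚ.- t n                  <⟨ ℚ.+-mono-<-≤ s+t<½ε (ℚ.neg-antimono-≤ -½ε≤t) ⟩
    ½ ℚ.* ε ℚ.- ℚ.- (½ ℚ.* ε)                ≡⟨ solve 1 (λ e → e :- :- e := e :+ e) ≡.refl (½ ℚ.* ε) ⟩
    ½ ℚ.* ε ℚ.+ ½ ℚ.* ε                      ≡⟨ ½*+½* ε ⟩
    ε                                        ∎)
  (t-nonNeg _ (0<½* 0<ε)) (s+t-null _ (0<½* 0<ε))
  where open ℚ.≤-Reasoning

0<⇒nonNeg : ∀ x → 0ᵣ <ᵣ x → NonNeg (seq x)
0<⇒nonNeg x (η , 0<η , N , η<x) ε 0<ε = N , λ n N≤n → begin
  ℚ.- ε      ≤⟨ ℚ.neg-antimono-≤ (ℚ.<⇒≤ 0<ε) ⟩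
  0ℚ         ≤⟨ ℚ.<⇒≤ 0<η ⟩
  η          ≡⟨ ℚ.+-identityˡ η ⟨
  0ℚ ℚ.+ η   ≤⟨ ℚ.<⇒≤ (η<x n N≤n) ⟩
  seq x n    ∎
  where open ℚ.≤-Reasoning

-- Constructive, because the order on ℚ is decidable. A single term below - ε beyond the Cauchy
-- index for ε / 2 would force all terms beyond that index below - ε / 2, which is x < 0 with gap ε
-- / 2.
≮0⇒nonNeg : ∀ x → ¬ (x <ᵣ 0ᵣ) → NonNeg (seq x)
≮0⇒nonNeg x x≮0 ε 0<ε with cauchy x _ (0<½* 0<ε)
... | N , close = N , λ n N≤n → ℚ.≮⇒≥ λ xn<-ε →
  x≮0 (½ ℚ.* ε , 0<½* 0<ε , N , λ m N≤m → begin-strict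
    seq x m ℚ.+ ½ ℚ.* ε
      ≡⟨ solve 3 (λ x y e → x :+ e := (x :- y) :+ (y :+ e)) ≡.refl (seq x m) (seq x n) _ ⟩
    (seq x m ℚ.- seq x n) ℚ.+ (seq x n ℚ.+ ½ ℚ.* ε)
      <⟨ ℚ.+-mono-≤-< (p≤∣p∣ (seq x m ℚ.- seq x n)) (ℚ.+-monoˡ-< (½ ℚ.* ε) xn<-ε) ⟩
    ∣ seq x m ℚ.- seq x n ∣ ℚ.+ (ℚ.- ε ℚ.+ ½ ℚ.* ε)
      <⟨ ℚ.+-monoˡ-< (ℚ.- ε ℚ.+ ½ ℚ.* ε) (close m n N≤m N≤n) ⟩
    ½ ℚ.* ε ℚ.+ (ℚ.- ε ℚ.+ ½ ℚ.* ε)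
      ≡⟨ solve 2 (λ d e → d :+ (:- e :+ d) := (d :+ d) :- e) ≡.refl (½ ℚ.* ε) ε ⟩
    (½ ℚ.* ε ℚ.+ ½ ℚ.* ε) ℚ.- ε
      ≡⟨ ≡.cong (ℚ._- ε) (½*+½* ε) ⟩
    ε ℚ.- ε
      ≡⟨ ℚ.+-inverseʳ ε ⟩
    0ℚ ∎)
  where open ℚ.≤-Reasoning

-- The complex numbers as a commutative ring.

≗⇒≈ᵣ : ∀ {x y} → (∀ n → seq x n ≡ seq y n) → x ≈ᵣ y
≗⇒≈ᵣ {x} {y} x≗y = null-resp
  (λ n → ≡.sym (≡.trans (≡.cong (ℚ._- seq y n) (x≗y n)) (ℚ.+-inverseʳ (seq y n)))) null-0

≈ᵣ-sym : ∀ {x y} → x ≈ᵣ y → y ≈ᵣ x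
≈ᵣ-sym {x} {y} x≈y = null-resp
  (λ n → solve 2 (λ x y → :- (x :- y) := y :- x) ≡.refl (seq x n) (seq y n)) (null-neg x≈y)

≈ᵣ-trans : ∀ {x y z} → x ≈ᵣ y → y ≈ᵣ z → x ≈ᵣ z
≈ᵣ-trans {x} {y} {z} x≈y y≈z = null-resp
  (λ n → solve 3 (λ x y z → (x :- y) :+ (y :- z) := x :- z) ≡.refl (seq x n) (seq y n) (seq z n))
  (null-+ x≈y y≈z)

+ᵣ-cong : ∀ {x x′ y y′} → x ≈ᵣ x′ → y ≈ᵣ y′ → x +ᵣ y ≈ᵣ x′ +ᵣ y′
+ᵣ-cong {x} {x′} {y} {y′} x≈x′ y≈y′ = null-resp
  (λ n → solve 4 (λ x x′ y y′ → (x :- x′) :+ (y :- y′) := (x :+ y) :- (x′ :+ y′))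
    ≡.refl (seq x n) (seq x′ n) (seq y n) (seq y′ n))
  (null-+ x≈x′ y≈y′)

-ᵣ-cong : ∀ {x y} → x ≈ᵣ y → -ᵣ x ≈ᵣ -ᵣ y
-ᵣ-cong {x} {y} x≈y = null-resp
  (λ n → solve 2 (λ x y → :- (x :- y) := :- x :- :- y) ≡.refl (seq x n) (seq y n)) (null-neg x≈y)

bounded : ∀ x → Bounded (seq x)
bounded x = cauchy⇒bounded (cauchy x)

*ᵣ-cong : ∀ {x x′ y y′} → x ≈ᵣ x′ → y ≈ᵣ y′ → x *ᵣ y ≈ᵣ x′ *ᵣ y′
*ᵣ-cong {x} {x′} {y} {y′} x≈x′ y≈y′ = null-resp
  (λ n → solve 4 (λ x x′ y y′ → (x :- x′) :* y :+ (y :- y′) :* x′ := x :* y :- x′ :* y′)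
    ≡.refl (seq x n) (seq x′ n) (seq y n) (seq y′ n))
  (null-+ (null-*-bounded x≈x′ (bounded y)) (null-*-bounded y≈y′ (bounded x′)))

-- The equality of ℂ-rawRing as a record, so that z and w can be inferred from z ≃ w.
infix 4 _≃_ _&_

record _≃_ (z w : ℂ) : Set where
  constructor _&_
  field
    Re-≈ : Re z ≈ᵣ Re w
    Im-≈ : Im z ≈ᵣ Im w

re im : ℂ → ℕ → ℚ
re z n = seq (Re z) n
im z n = seq (Im z) n

-- The operations act termwise on sequences, so the ring laws of ℂ reduce to polynomial identities
-- over ℚ.
≗⇒≈ : ∀ {z w} → (∀ n → re z n ≡ re w n) → (∀ n → im z n ≡ im w n) → z ≃ w
≗⇒≈ {z} {w} re≗ im≗ =
  ≗⇒≈ᵣ {Re z} {Re w} re≗ & ≗⇒≈ᵣ {Im z} {Im w} im≗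

-- Opaque, so that conversion checking never unfolds the Cauchy proofs carried by ℂ.
opaque

  infixl 6 _+_
  infixl 7 _*_
  infix  8 -_

  _+_ _*_ : ℂ → ℂ → ℂ
  _+_ = RawRing._+_ ℂ-rawRing
  _*_ = RawRing._*_ ℂ-rawRing

  -_ : ℂ → ℂ
  -_ = RawRing.-_ ℂ-rawRing

  0# 1# : ℂ
  0# = RawRing.0# ℂ-rawRing
  1# = RawRing.1# ℂ-rawRing

opaque
  unfolding _+_

  isCommutativeRing : IsCommutativeRing _≃_ _+_ _*_ -_ 0# 1#
  isCommutativeRing = record
    { isRing = record
      { +-isAbelianGroup = record
        { isGroup = record
          { isMonoid = record
            { isSemigroup = record
              { isMagma = record
                { isEquivalence = record
                  { refl = λ {z} → ≗⇒≈ (λ _ → ≡.refl) (λ _ → ≡.refl)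
                  ; sym = λ {z} {w} (p & q) →
                      ≈ᵣ-sym {Re z} {Re w} p & ≈ᵣ-sym {Im z} {Im w} q
                  ; trans = λ {z} {w} {u} (p & q) (p′ & q′) →
                      ≈ᵣ-trans {Re z} {Re w} {Re u} p p′ & ≈ᵣ-trans {Im z} {Im w} {Im u} q q′
                  }
                ; ∙-cong = λ {z} {z′} {w} {w′} (p & q) (p′ & q′) →
                    +ᵣ-cong {Re z} {Re z′} {Re w} {Re w′} p p′ &
                    +ᵣ-cong {Im z} {Im z′} {Im w} {Im w′} q q′
                }
              ; assoc = λ z w u → ≗⇒≈ {(z + w) + u} {z + (w + u)}
                  (λ n → ℚ.+-assoc (re z n) (re w n) (re u n))
                  (λ n → ℚ.+-assoc (im z n) (im w n) (im u n))
              }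
            ; identity =
                (λ z → ≗⇒≈ (λ n → ℚ.+-identityˡ (re z n)) (λ n → ℚ.+-identityˡ (im z n)))
              , (λ z → ≗⇒≈ (λ n → ℚ.+-identityʳ (re z n)) (λ n → ℚ.+-identityʳ (im z n)))
            }
          ; inverse =
              (λ z → ≗⇒≈ (λ n → ℚ.+-inverseˡ (re z n)) (λ n → ℚ.+-inverseˡ (im z n)))
            , (λ z → ≗⇒≈ (λ n → ℚ.+-inverseʳ (re z n)) (λ n → ℚ.+-inverseʳ (im z n)))
          ; ⁻¹-cong = λ {z} {w} (p & q) → -ᵣ-cong {Re z} {Re w} p & -ᵣ-cong {Im z} {Im w} q
          }
        ; comm = λ z w → ≗⇒≈ {z + w} {w + z}
            (λ n → ℚ.+-comm (re z n) (re w n)) (λ n → ℚ.+-comm (im z n) (im w n))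
        }
      ; *-cong = λ {z} {z′} {w} {w′} (p & q) (p′ & q′) →
          +ᵣ-cong {Re z *ᵣ Re w} {Re z′ *ᵣ Re w′} { -ᵣ (Im z *ᵣ Im w)} { -ᵣ (Im z′ *ᵣ Im w′)}
            (*ᵣ-cong {Re z} {Re z′} {Re w} {Re w′} p p′)
            (-ᵣ-cong {Im z *ᵣ Im w} {Im z′ *ᵣ Im w′}
              (*ᵣ-cong {Im z} {Im z′} {Im w} {Im w′} q q′)) &
          +ᵣ-cong {Re z *ᵣ Im w} {Re z′ *ᵣ Im w′} {Im z *ᵣ Re w} {Im z′ *ᵣ Re w′}
            (*ᵣ-cong {Re z} {Re z′} {Im w} {Im w′} p q′)
            (*ᵣ-cong {Im z} {Im z′} {Re w} {Re w′} q p′)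
      ; *-assoc = λ z w u → ≗⇒≈ {(z * w) * u} {z * (w * u)}
          (λ n → solve 6 (λ a b c d e f →
            (a :* c :+ :- (b :* d)) :* e :+ :- ((a :* d :+ b :* c) :* f) :=
            a :* (c :* e :+ :- (d :* f)) :+ :- (b :* (c :* f :+ d :* e)))
            ≡.refl (re z n) (im z n) (re w n) (im w n) (re u n) (im u n))
          (λ n → solve 6 (λ a b c d e f →
            (a :* c :+ :- (b :* d)) :* f :+ (a :* d :+ b :* c) :* e :=
            a :* (c :* f :+ d :* e) :+ b :* (c :* e :+ :- (d :* f)))
            ≡.refl (re z n) (im z n) (re w n) (im w n) (re u n) (im u n))
      ; *-identity =
          (λ z → ≗⇒≈ {1# * z} {z}
            (λ n → solve 2 (λ a b → con 1ℚ :* a :+ :- (con 0ℚ :* b) := a) ≡.refl (re z n) (im z n))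
            (λ n → solve 2 (λ a b → con 1ℚ :* b :+ con 0ℚ :* a := b) ≡.refl (re z n) (im z n)))
        , (λ z → ≗⇒≈ {z * 1#} {z}
            (λ n → solve 2 (λ a b → a :* con 1ℚ :+ :- (b :* con 0ℚ) := a) ≡.refl (re z n) (im z n))
            (λ n → solve 2 (λ a b → a :* con 0ℚ :+ b :* con 1ℚ := b) ≡.refl (re z n) (im z n)))
      ; distrib =
          (λ z w u → ≗⇒≈ {z * (w + u)} {z * w + z * u}
            (λ n → solve 6 (λ a b c d e f →
              a :* (c :+ e) :+ :- (b :* (d :+ f)) :=
              (a :* c :+ :- (b :* d)) :+ (a :* e :+ :- (b :* f)))
              ≡.refl (re z n) (im z n) (re w n) (im w n) (re u n) (im u n))
            (λ n → solve 6 (λ a b c d e f →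
              a :* (d :+ f) :+ b :* (c :+ e) :=
              (a :* d :+ b :* c) :+ (a :* f :+ b :* e))
              ≡.refl (re z n) (im z n) (re w n) (im w n) (re u n) (im u n)))
        , (λ z w u → ≗⇒≈ {(w + u) * z} {w * z + u * z}
            (λ n → solve 6 (λ a b c d e f →
              (c :+ e) :* a :+ :- ((d :+ f) :* b) :=
              (c :* a :+ :- (d :* b)) :+ (e :* a :+ :- (f :* b)))
              ≡.refl (re z n) (im z n) (re w n) (im w n) (re u n) (im u n))
            (λ n → solve 6 (λ a b c d e f →
              (c :+ e) :* b :+ (d :+ f) :* a :=
              (c :* b :+ d :* a) :+ (e :* b :+ f :* a))
              ≡.refl (re z n) (im z n) (re w n) (im w n) (re u n) (im u n)))
      }
    ; *-comm = λ z w → ≗⇒≈ {z * w} {w * z}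
        (λ n → solve 4 (λ a b c d → a :* c :+ :- (b :* d) := c :* a :+ :- (d :* b))
          ≡.refl (re z n) (im z n) (re w n) (im w n))
        (λ n → solve 4 (λ a b c d → a :* d :+ b :* c := c :* b :+ d :* a)
          ≡.refl (re z n) (im z n) (re w n) (im w n))
    }

ℂ-commutativeRing : CommutativeRing 0ℓ 0ℓ
ℂ-commutativeRing = record { isCommutativeRing = isCommutativeRing }

open Evaluation ℂ-rawRing

opaque
  unfolding _+_

  -- The source has the transparent operations in which `ℛ` is built, the target their opaque
  -- copies. They coincide on unfolding, and this map hides that from the rest of the argument.
  id-isHom : RingMorphisms.IsRingHomomorphism ℂ-rawRing (CommutativeRing.rawRing ℂ-commutativeRing) id
  id-isHom = record
    { isSemiringHomomorphism = record
      { isNearSemiringHomomorphism = record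
        { +-isMonoidHomomorphism = record
          { isMagmaHomomorphism = record
            { isRelHomomorphism = record { cong = λ (p , q) → p & q }
            ; homo = λ z w → ≗⇒≈ (λ _ → ≡.refl) (λ _ → ≡.refl)
            }
          ; ε-homo = ≗⇒≈ (λ _ → ≡.refl) (λ _ → ≡.refl)
          }
        ; *-homo = λ z w → ≗⇒≈ (λ _ → ≡.refl) (λ _ → ≡.refl)
        }
      ; 1#-homo = ≗⇒≈ (λ _ → ≡.refl) (λ _ → ≡.refl)
      }
    ; -‿homo = λ z → ≗⇒≈ (λ _ → ≡.refl) (λ _ → ≡.refl)
    }

open CommutativeRing ℂ-commutativeRing hiding (_+_; _*_; -_; 0#; 1#; isCommutativeRing)
open Hom ℂ-commutativeRing id-isHom

opaque
  unfolding _+_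

  +-unfold : ∀ z w → RawRing._+_ ℂ-rawRing z w ≡ z + w
  +-unfold _ _ = ≡.refl

  *-unfold : ∀ z w → RawRing._*_ ℂ-rawRing z w ≡ z * w
  *-unfold _ _ = ≡.refl

  0#-unfold : RawRing.0# ℂ-rawRing ≡ 0#
  0#-unfold = ≡.refl

eval≡evalAt : ∀ p z → eval p z ≡ evalAt p z
eval≡evalAt []      z = 0#-unfold
eval≡evalAt (a ∷ p) z = ≡.trans (+-unfold a (RawRing._*_ ℂ-rawRing z (eval p z)))
  (≡.cong (a +_) (≡.trans (*-unfold z (eval p z)) (≡.cong (z *_) (eval≡evalAt p z))))

-- Angles between complex numbers, with `dot z w` the real part of z times the conjugate of w.

dot : ℂ → ℂ → ℝ
dot z w = Re z *ᵣ Re w +ᵣ Im z *ᵣ Im w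

-- ∣ arg (z / w) ∣ ≤ π/2.
record Acute (z w : ℂ) : Set where
  constructor acute
  field
    dot-nonNeg : NonNeg (seq (dot z w))

Acute-resp : ∀ {z z′ w w′} → z ≈ z′ → w ≈ w′ → Acute z w → Acute z′ w′
Acute-resp {z} {z′} {w} {w′} (p & q) (p′ & q′) (acute zw≥0) = acute (nonNeg-resp
  (λ n → solve 2 (λ x y → x :+ :- (x :- y) := y) ≡.refl (seq (dot z w) n) (seq (dot z′ w′) n))
  (nonNeg-null-+ zw≥0 (null-neg
    (+ᵣ-cong {Re z *ᵣ Re w} {Re z′ *ᵣ Re w′} {Im z *ᵣ Im w} {Im z′ *ᵣ Im w′}
      (*ᵣ-cong {Re z} {Re z′} {Re w} {Re w′} p p′)
      (*ᵣ-cong {Im z} {Im z′} {Im w} {Im w′} q q′)))))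

opaque
  unfolding _+_

  dot-+ˡ : ∀ x y z n → seq (dot x z) n ℚ.+ seq (dot y z) n ≡ seq (dot (x + y) z) n
  dot-+ˡ x y z n = solve 6 (λ x x′ y y′ z z′ →
    (x :* z :+ x′ :* z′) :+ (y :* z :+ y′ :* z′) := (x :+ y) :* z :+ (x′ :+ y′) :* z′)
    ≡.refl (re x n) (im x n) (re y n) (im y n) (re z n) (im z n)

Acute-0 : ∀ z → Acute (RawRing.0# ℂ-rawRing) z
Acute-0 z = acute λ ε 0<ε → 0 , λ n _ → ≡.subst (ℚ.- ε ℚ.≤_)
  (solve 2 (λ x y → con 0ℚ := con 0ℚ :* x :+ con 0ℚ :* y) ≡.refl (re z n) (im z n))
  (ℚ.neg-antimono-≤ (ℚ.<⇒≤ 0<ε))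

Acute-+ : ∀ {x y z} → Acute x z → Acute y z → Acute (x + y) z
Acute-+ {x} {y} {z} (acute xz≥0) (acute yz≥0) =
  acute (nonNeg-resp (dot-+ˡ x y z) (nonNeg-+ xz≥0 yz≥0))

-- Re (a / b) > 0, written without division.
Admissible : ℂ × ℂ → Set
Admissible (a , b) = 0ᵣ <ᵣ dot a b

NonVanishing : ∀ {n} → Form n → Set
NonVanishing t = ∀ v → All Admissible v → ¬ (value t v ≈ 0#)

-- Solver expressions for a real and an imaginary part. The operations below copy the formulas of ℂ
-- and of `dot` literally, so that a complex expression can be reflected as a whole and still
-- denotes the right terms by computation.
ℂ-Polynomial : ℕ → Set
ℂ-Polynomial m = Polynomial m × Polynomial m

_⊞_ _⊡_ : ∀ {m} → ℂ-Polynomial m → ℂ-Polynomial m → ℂ-Polynomial m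
(x , x′) ⊞ (y , y′) = x :+ y , x′ :+ y′
(x , x′) ⊡ (y , y′) = x :* y :+ :- (x′ :* y′) , x :* y′ :+ x′ :* y

_⟨⟩_ : ∀ {m} → ℂ-Polynomial m → ℂ-Polynomial m → Polynomial m
(x , x′) ⟨⟩ (y , y′) = x :* y :+ x′ :* y′

1ₚ : ∀ {m} → ℂ-Polynomial m
1ₚ = con 1ℚ , con 0ℚ

opaque
  unfolding _+_

  -- The contribution of one pair of variables: the substitution in that pair, compared with the
  -- form itself. The dot product splits into `dot a b` and `dot α β` with the weights `n₁` = ∣α∣² +
  -- 4∣β∣² and `n₂` = ∣b∣² + 4∣a∣².
  Acute-swap : ∀ {α β a b} → Acute a b → Acute α β →
    Acute (a * (4# * β) + b * α) (a * α + b * β)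
  Acute-swap {α} {β} {a} {b} (acute ab≥0) (acute αβ≥0) = acute (nonNeg-resp
    (λ n → solve 8 (λ α α′ β β′ a a′ b b′ →
        let αᶜ = α , α′ ; βᶜ = β , β′ ; aᶜ = a , a′ ; bᶜ = b , b′
            n₁ = (αᶜ ⟨⟩ αᶜ) :+ con 4ℚ :* (βᶜ ⟨⟩ βᶜ)
            n₂ = (bᶜ ⟨⟩ bᶜ) :+ con 4ℚ :* (aᶜ ⟨⟩ aᶜ)
        in (aᶜ ⟨⟩ bᶜ) :* n₁ :+ (αᶜ ⟨⟩ βᶜ) :* n₂
           := ((aᶜ ⊡ ((1ₚ ⊞ (1ₚ ⊞ (1ₚ ⊞ 1ₚ))) ⊡ βᶜ)) ⊞ (bᶜ ⊡ αᶜ)) ⟨⟩ ((aᶜ ⊡ αᶜ) ⊞ (bᶜ ⊡ βᶜ)))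
        ≡.refl (re α n) (im α n) (re β n) (im β n) (re a n) (im a n) (re b n) (im b n))
    (nonNeg-+
      -- The weights are sums of squares at every index, hence nonnegative termwise and not merely
      -- in the limit, as `nonNeg-*` requires; they are bounded because they come from real numbers.
      (nonNeg-* ab≥0 (λ n → weights≥0 α β n) (bounded (dot α α +ᵣ 4ᵣ *ᵣ dot β β)))
      (nonNeg-* αβ≥0 (λ n → weights≥0 b a n) (bounded (dot b b +ᵣ 4ᵣ *ᵣ dot a a)))))
    where
    4ℚ : ℚ
    4ℚ = 1ℚ ℚ.+ (1ℚ ℚ.+ (1ℚ ℚ.+ 1ℚ))
    4ᵣ : ℝ
    4ᵣ = 1ᵣ +ᵣ (1ᵣ +ᵣ (1ᵣ +ᵣ 1ᵣ))
    norm≥0 : ∀ z n → 0ℚ ℚ.≤ seq (dot z z) n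
    norm≥0 z n = ℚ.+-mono-≤ (0≤² (re z n)) (0≤² (im z n))
    weights≥0 : ∀ z w n → 0ℚ ℚ.≤ seq (dot z z) n ℚ.+ 4ℚ ℚ.* seq (dot w w) n
    weights≥0 z w n = ℚ.+-mono-≤ (norm≥0 z n) (0≤* (ℚ.nonNegative⁻¹ 4ℚ) (norm≥0 w n))

-x*y+y*x≈0 : ∀ x y → - x * y + y * x ≈ 0#
-x*y+y*x≈0 x y = begin
  - x * y + y * x   ≈⟨ +-congˡ (*-comm y x) ⟩
  - x * y + x * y   ≈⟨ distribʳ y (- x) x ⟨
  (- x + x) * y     ≈⟨ *-congʳ (-‿inverseˡ x) ⟩
  0# * y            ≈⟨ zeroˡ y ⟩
  0#                ∎
  where open SetoidReasoning setoid

opaque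
  unfolding _+_

  -- `dot (- y) x` is the negative of `dot x y`, so the same gap ε serves.
  obtuse⇒admissible : ∀ x y → dot x y <ᵣ 0ᵣ → Admissible (- y , x)
  obtuse⇒admissible x y (ε , 0<ε , N , dot<0) = ε , 0<ε , N , λ n N≤n →
    neg-swap (re x n) (im x n) (re y n) (im y n) (dot<0 n N≤n)
    where
    neg-swap : ∀ a a′ b b′ → (a ℚ.* b ℚ.+ a′ ℚ.* b′) ℚ.+ ε ℚ.< 0ℚ →
      0ℚ ℚ.+ ε ℚ.< ℚ.- b ℚ.* a ℚ.+ ℚ.- b′ ℚ.* a′
    neg-swap a a′ b b′ lt = ≡.subst₂ ℚ._<_
      (solve 5 (λ a a′ b b′ e → (a :* b :+ a′ :* b′ :+ e) :- (a :* b :+ a′ :* b′) := con 0ℚ :+ e)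
        ≡.refl a a′ b b′ ε)
      (solve 4 (λ a a′ b b′ → con 0ℚ :- (a :* b :+ a′ :* b′) := :- b :* a :+ :- b′ :* a′)
        ≡.refl a a′ b b′)
      (ℚ.+-monoˡ-< (ℚ.- (a ℚ.* b ℚ.+ a′ ℚ.* b′)) lt)

-- If the coefficients formed an obtuse angle, the first pair (- β , α) would be admissible and
-- would annihilate α a + β b. This only refutes a strict inequality, which is exactly what
-- `≮0⇒nonNeg` accepts.
nonVanishing⇒Acute : ∀ {n} (α β : Form n) → NonVanishing (form α β) →
  ∀ v → All Admissible v → Acute (value α v) (value β v)
nonVanishing⇒Acute α β nv v adm = acute (≮0⇒nonNeg (dot (value α v) (value β v)) λ dot<0 →
  nv ((- value β v , value α v) ∷ v)
    (obtuse⇒admissible (value α v) (value β v) dot<0 ∷ adm)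
    (-x*y+y*x≈0 (value β v) (value α v)))

-- The first pair contributes `P`, handled by `Acute-swap`. The others contribute `Q`, the value of
-- `D` on the form `t` obtained by fixing the first pair at (a , b). A zero of `t` would extend to a
-- zero of the whole form, so the induction, on the number of pairs, applies to `t`.
Acute-D : ∀ {n} (t : Form n) → NonVanishing t →
  ∀ v → All Admissible v → Acute (value (D t) v) (value t v)
Acute-D (const k) nv [] [] = Acute-0 k
Acute-D (form α β) nv ((a , b) ∷ v) (ab>0 ∷ adm) =
  Acute-resp {w = T} {w′ = T} (sym split) refl (Acute-+
    (Acute-swap (acute (0<⇒nonNeg (dot a b) ab>0)) (nonVanishing⇒Acute α β nv v adm))
    (Acute-resp value-D-t (value-combine v) (Acute-D t
      (λ w adm-w t≈0 → nv ((a , b) ∷ w) (ab>0 ∷ adm-w) (trans (sym (value-combine w)) t≈0))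
      v adm)))
  where
  open SetoidReasoning setoid
  A B P Q T : ℂ
  A = value α v
  B = value β v
  P = a * (4# * B) + b * A
  Q = a * value (D α) v + b * value (D β) v
  T = a * A + b * B
  t = scale a α +ᶠ scale b β
  value-combine : ∀ w → value t w ≈ a * value α w + b * value β w
  value-combine w = trans (value-+ (scale a α) (scale b β) w)
    (+-cong (value-scale a α w) (value-scale b β w))
  value-D-t : value (D t) v ≈ Q
  value-D-t = trans (value-D-+ (scale a α) (scale b β) v)
    (+-cong (value-D-scale a α v) (value-D-scale b β v))
  split : value (D (form α β)) ((a , b) ∷ v) ≈ P + Q
  split = begin
    value (D (form α β)) ((a , b) ∷ v)
      ≈⟨ value-D α β a b v ⟩
    a * (4# * B + value (D α) v) + b * (A + value (D β) v)
      ≈⟨ +-cong (distribˡ a (4# * B) (value (D α) v)) (distribˡ b A (value (D β) v)) ⟩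
    (a * (4# * B) + a * value (D α) v) + (b * A + b * value (D β) v)
      ≈⟨ interchange (a * (4# * B)) (a * value (D α) v) (b * A) (b * value (D β) v) ⟩
    P + Q ∎
    where open CommutativeSemigroupProperties +-commutativeSemigroup using (interchange)

-- Cancellation in the complex numbers.

conj : ℂ → ℂ
conj z = Re z +i -ᵣ Im z

opaque
  unfolding _+_

  ≈0⇒null : ∀ {z} → z ≈ 0# → Null (re z) × Null (im z)
  ≈0⇒null {z} (re≈0 & im≈0) = null-resp (λ n → ℚ.+-identityʳ (re z n)) re≈0
    , null-resp (λ n → ℚ.+-identityʳ (im z n)) im≈0

  null⇒≈0 : ∀ {z} → Null (re z) → Null (im z) → z ≈ 0#
  null⇒≈0 {z} re-null im-null = null-resp (λ n → ≡.sym (ℚ.+-identityʳ (re z n))) re-null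
    & null-resp (λ n → ≡.sym (ℚ.+-identityʳ (im z n))) im-null

  1≉0 : ¬ (1# ≈ 0#)
  1≉0 (re≈0 & _) with re≈0 1ℚ (ℚ.positive⁻¹ 1ℚ)
  ... | N , close = ℚ.<-irrefl ≡.refl (close N ℕ.≤-refl)

  re-conj-* : ∀ a b n → seq (dot a b) n ≡ re (conj b * a) n
  re-conj-* a b n = solve 4 (λ a a′ b b′ → a :* b :+ a′ :* b′ := b :* a :+ :- (:- b′ :* a′))
    ≡.refl (re a n) (im a n) (re b n) (im b n)

  re-conj-*-* : ∀ c z n → re (conj c * (c * z)) n ≡ seq (dot c c) n ℚ.* re z n
  re-conj-*-* c z n = solve 4 (λ c c′ z z′ →
    c :* (c :* z :+ :- (c′ :* z′)) :+ :- (:- c′ :* (c :* z′ :+ c′ :* z)) :=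
    (c :* c :+ c′ :* c′) :* z) ≡.refl (re c n) (im c n) (re z n) (im z n)

  im-conj-*-* : ∀ c z n → im (conj c * (c * z)) n ≡ seq (dot c c) n ℚ.* im z n
  im-conj-*-* c z n = solve 4 (λ c c′ z z′ →
    c :* (c :* z′ :+ c′ :* z) :+ :- c′ :* (c :* z :+ :- (c′ :* z′)) :=
    (c :* c :+ c′ :* c′) :* z′) ≡.refl (re c n) (im c n) (re z n) (im z n)

-- Multiplying by the conjugate of c turns c z into ∣c∣² z, which separates real and imaginary
-- parts. Since ∣c∣² ≥ (Re c)² ≥ ε² eventually, `null-cancel-*` applies to each.
cancel-0<Re : ∀ {c z ε} → 0ℚ ℚ.< ε → Eventually (λ n → ε ℚ.≤ re c n) → c * z ≈ 0# → z ≈ 0#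
cancel-0<Re {c} {z} {ε} 0<ε ε≤c cz≈0 = null⇒≈0
  (null-cancel-* 0<εε εε≤cc (null-resp (re-conj-*-* c z) (proj₁ c̄cz-null)))
  (null-cancel-* 0<εε εε≤cc (null-resp (im-conj-*-* c z) (proj₂ c̄cz-null)))
  where
  c̄cz-null : Null (re (conj c * (c * z))) × Null (im (conj c * (c * z)))
  c̄cz-null = ≈0⇒null (trans (*-congˡ cz≈0) (zeroʳ (conj c)))
  0<εε : 0ℚ ℚ.< ε ℚ.* ε
  0<εε = 0<* 0<ε 0<ε
  εε≤cc : Eventually (λ n → ε ℚ.* ε ℚ.≤ seq (dot c c) n)
  εε≤cc = eventually-map (λ n ε≤c → begin
    ε ℚ.* ε                                   ≤⟨ ℚ.*-monoˡ-≤-nonNeg ε {{nonNegative (ℚ.<⇒≤ 0<ε)}} ε≤c ⟩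
    ε ℚ.* re c n                              ≤⟨ ℚ.*-monoʳ-≤-nonNeg (re c n)
                                                   {{nonNegative (ℚ.≤-trans (ℚ.<⇒≤ 0<ε) ε≤c)}} ε≤c ⟩
    re c n ℚ.* re c n                         ≡⟨ ℚ.+-identityʳ _ ⟨
    re c n ℚ.* re c n ℚ.+ 0ℚ                  ≤⟨ ℚ.+-monoʳ-≤ (re c n ℚ.* re c n) (0≤² (im c n)) ⟩
    seq (dot c c) n                           ∎) ε≤c
    where open ℚ.≤-Reasoning

-- Nothing is known about the sign of Re a, but a times the conjugate of b has real part `dot a b`,
-- which is positive. So the equation is first multiplied by that conjugate.
cancel-admissible : ∀ {a b z} → Admissible (a , b) → a * z ≈ 0# → z ≈ 0#
cancel-admissible {a} {b} {z} (ε , 0<ε , N , ε<ab) az≈0 = cancel-0<Re {conj b * a} 0<ε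
  (N , λ n N≤n → ℚ.<⇒≤ (≡.subst₂ ℚ._<_ (ℚ.+-identityˡ ε) (re-conj-* a b n) (ε<ab n N≤n)))
  (trans (*-assoc (conj b) a z) (trans (*-congˡ az≈0) (zeroʳ (conj b))))

-- Pairing z + w with z gives that ∣z∣² + `dot w z` is null. The first term is nonnegative and the
-- second is so in the limit, hence ∣z∣² is null; it dominates the squares of Re z and Im z.
acute-summand : ∀ {z w} → Acute w z → z + w ≈ 0# → z ≈ 0#
acute-summand {z} {w} (acute wz≥0) z+w≈0 = null⇒≈0
  (null-√ (null-dominated
    (λ n → abs-mono (0≤² (re z n)) (summand≤ (0≤² (im z n)))) zz-null))
  (null-√ (null-dominated
    (λ n → abs-mono (0≤² (im z n)) (≡.subst (im z n ℚ.* im z n ℚ.≤_)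
      (ℚ.+-comm (im z n ℚ.* im z n) (re z n ℚ.* re z n)) (summand≤ (0≤² (re z n))))) zz-null))
  where
  abs-mono : ∀ {p q} → 0ℚ ℚ.≤ p → p ℚ.≤ q → ∣ p ∣ ℚ.≤ ∣ q ∣
  abs-mono 0≤p p≤q = ≡.subst₂ ℚ._≤_ (≡.sym (ℚ.0≤p⇒∣p∣≡p 0≤p))
    (≡.sym (ℚ.0≤p⇒∣p∣≡p (ℚ.≤-trans 0≤p p≤q))) p≤q
  summand≤ : ∀ {p q} → 0ℚ ℚ.≤ q → p ℚ.≤ p ℚ.+ q
  summand≤ {p} 0≤q = ≡.subst (ℚ._≤ p ℚ.+ _) (ℚ.+-identityʳ p) (ℚ.+-monoʳ-≤ p 0≤q)
  z+w-null = ≈0⇒null z+w≈0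
  zz-null : Null (seq (dot z z))
  zz-null = null-summand (λ n → ℚ.+-mono-≤ (0≤² (re z n)) (0≤² (im z n))) wz≥0
    (null-resp (λ n → ≡.sym (dot-+ˡ z w z n))
      (null-+ (null-*-bounded (proj₁ z+w-null) (bounded (Re z)))
              (null-*-bounded (proj₂ z+w-null) (bounded (Im z)))))

-- Zero-freeness of `ℱ n` and stability of `ℛ n`.

ℱ-nonVanishing : ∀ n → NonVanishing (ℱ n)
ℱ-nonVanishing zero    []            []          1≈0 = 1≉0 (trans (sym 1#-homo) 1≈0)
  where open RingMorphisms.IsRingHomomorphism id-isHom using (1#-homo)
-- With F = `ℱ n`, the factor a of a (F + D F) is cancelled, and the angle between D F and F then
-- forces F ≈ 0. The induction hypothesis serves twice: to obtain the angle and to refute F ≈ 0.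
ℱ-nonVanishing (suc n) ((a , b) ∷ v) (ab>0 ∷ adm) ℱ≈0 = ℱ-nonVanishing n v adm
  (acute-summand (Acute-D (ℱ n) (ℱ-nonVanishing n) v adm)
    (cancel-admissible {b = b} ab>0 (trans (sym (value-ℱ n a b v)) ℱ≈0)))

opaque
  unfolding _+_

  -- The real part of z times the conjugate of 1 + z² is Re z (1 + ∣z∣²), which is at least Re z, so
  -- the gap of Re z carries over.
  diagonal-admissible : ∀ z → 0ᵣ <ᵣ Re z → Admissible (z , 1# + z * z)
  diagonal-admissible z (ε , 0<ε , N , ε<z) = ε , 0<ε , N , λ n N≤n →
    ℚ.<-≤-trans (ε<z n N≤n) (bound (re z n) (im z n)
      (ℚ.<⇒≤ (ℚ.<-trans 0<ε (≡.subst (ℚ._< re z n) (ℚ.+-identityˡ ε) (ε<z n N≤n)))))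
    where
    bound : ∀ x y → 0ℚ ℚ.≤ x → x ℚ.≤
      x ℚ.* (1ℚ ℚ.+ (x ℚ.* x ℚ.+ ℚ.- (y ℚ.* y))) ℚ.+ y ℚ.* (0ℚ ℚ.+ (x ℚ.* y ℚ.+ y ℚ.* x))
    bound x y 0≤x = ≡.subst₂ ℚ._≤_ (ℚ.+-identityʳ x)
      (solve 2 (λ x y → x :+ x :* (x :* x :+ y :* y) :=
        x :* (con 1ℚ :+ (x :* x :+ :- (y :* y))) :+ y :* (con 0ℚ :+ (x :* y :+ y :* x)))
        ≡.refl x y)
      (ℚ.+-monoʳ-≤ x (0≤* 0≤x (ℚ.+-mono-≤ (0≤² x) (0≤² y))))

  ≈⇒≃0 : ∀ {z} → RawRing._≈_ ℂ-rawRing z (RawRing.0# ℂ-rawRing) → z ≈ 0#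
  ≈⇒≃0 (re≈0 , im≈0) = re≈0 & im≈0

replicate⁺ : ∀ n {p} → Admissible p → All Admissible (replicate n p)
replicate⁺ zero    _   = []
replicate⁺ (suc n) adm = adm ∷ replicate⁺ n adm

proposition2p16 : ∀ (n : ℕ) → HurwitzStable (ℛ n)
proposition2p16 n = inj₂ λ z 0<z ℛ≈0 →
  ℱ-nonVanishing n (replicate n (z , 1# + z * z))
    (replicate⁺ n (diagonal-admissible z 0<z))
    (trans (sym (eval-ℛ n ℂ-commutativeRing id-isHom z))
      (trans (reflexive (≡.sym (eval≡evalAt (ℛ n) z))) (≈⇒≃0 ℛ≈0)))
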